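{- In the mobile telephone model with tag length $b=1$ and any stability factor $\tau\ge1$, and with shared randomness available to all nodes, the SharedBit gossip algorithm solves the gossip problem in $O(kn)$ rounds, where $n$ is the network size and $k$ is the number of tokens.
   Context: Mobile telephone model. Time proceeds in synchronous rounds $1,2,\dots$, and all nodes start in round 1. The topology is a dynamic graph $G_1,G_2,\dots$ fixed before the execution begins, where each $G_r=(V,E_r)$ is a connected undirected graph on the same node set $V$, $|V|=n>1$. Stability factor $\tau\ge1$: at least $\tau$ rounds pass between any two changes of the topology ($\tau=1$: it may change arbitrarily every round; $\tau=\infty$: it never changes). At the beginning of round $r$ each node selects a tag of $b$ bits to advertise, then learns its neighbor set in $G_r$ and the tags of its neighbors. Each node may then send a connection proposal to at most one neighbor. A node that sends a proposal cannot receive one; a node that does not send a proposal and receives at least one proposal accepts one chosen uniformly at random among those received. A proposer and acceptor are then connected for the round and may exchange at most $O(1)$ tokens and $O(\mathrm{polylog}(N))$ additional bits. Gossip problem. Each node knows an upper bound $N\ge n$ and has a unique ID in $[N]=\{1,\dots,N\}$. There are $k$ tokens, $1\le k\le n$ ($k$ is not known to the nodes), each initially held by exactly one node; tokens are black boxes, labelled by distinct elements of $[N]$ (which orders them), that can only be passed through connections. $T_u(r)$ is the set of tokens known by $u$ at the beginning of round $r$. An algorithm solves gossip in $f$ rounds if, with probability at least $1-1/n$, all nodes know all $k$ tokens by round $f$. $O(\cdot)$ is asymptotic with universal constants. Transfer$(\varepsilon)$ subroutine. Run by two connected nodes $u,v$ with token sets $T_u,T_v$ (using fresh private randomness); if $T_u\ne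 T_v$, then with probability at least $1-\varepsilon$ the smallest token in $(T_u\cup T_v)\setminus(T_u\cap T_v)$ is transferred by the node that knows it to the node that does not. In all cases nodes only gain tokens that the other node knows. SharedBit. All nodes have access to a common uniformly random bit string $\hat r$ of length $cN^3(\lceil\log N\rceil+1)$, partitioned into $cN^2$ groups labelled $1,\dots,cN^2$, each consisting of $N$ bundles labelled $1,\dots,N$ of $\lceil\log N\rceil+1$ bits each. In round $r\le cN^2$, for each token $t\in T_u(r)$ let $t.\mathrm{bit}$ be the first bit of bundle $t$ of group $r$. Node $u$ advertises $b_u(r)=\left(\sum_{t\in T_u(r)}t.\mathrm{bit}\right)\bmod 2$ (and $b_u(r)=0$ if $T_u(r)=\emptyset$). If $b_u(r)=0$, $u$ sends no proposal and waits to receive proposals. If $b_u(r)=1$ and $u$ has at least one neighbor advertising $0$, then $u$ chooses one of these neighbors uniformly at random (the choice being made with the remaining $\lceil\log N\rceil$ bits of the bundle of group $r$ labelled by $u$'s ID, and treated as uniform) and sends it a proposal. Two nodes that connect run Transfer$(n^{ -c_t})$. Here $c,c_t\ge1$ are sufficiently large constants. After round $cN^2$ the behavior is arbitrary. -}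

module Defs where

open import Data.Bool.Base using (Bool; true; if_then_else_)
open import Data.Fin.Base using (Fin; zero; suc; toℕ; fromℕ<) renaming (_≤_ to _≤ᶠ_)
open import Data.Fin.Properties using (_≟_; any?; all?)
open import Data.Fin.Subset using (Subset; _∈_; _⊆_; _∪_; _∩_; _─_; ∣_∣)
open import Data.Fin.Subset.Properties using (_∈?_)
open import Data.Integer.Base using (1ℤ)
open import Data.List.Base using (List; []; _∷_; length; lookup; filter; allFin)
open import Data.List.Membership.Propositional using () renaming (_∈_ to _∈ˡ_)
open import Data.List.Membership.Propositional.Properties using (∈-lookup; ∈-filter⁻)
open import Data.Maybe.Base using (Maybe; just; nothing; maybe′)
open import Data.Maybe.Properties using (≡-dec)
open import Data.Maybe.Relation.Unary.All as MaybeAll using ()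
open import Data.Maybe using (Is-just)
open import Data.Maybe.Relation.Unary.Any using () renaming (just to is-just)
open import Data.Nat.Base using (ℕ; zero; suc; _+_; _*_; _^_; _≤_; _<_; NonZero; NonTrivial; nonTrivial⇒nonZero)
open import Data.Nat.DivMod using (_mod_)
open import Data.Nat.Logarithm using (⌈log₂_⌉)
open import Data.Nat.Properties using (_<?_; m^n≢0; +-0-commutativeMonoid)
open import Data.Product.Base using (∃; ∃-syntax; _×_; _,_; proj₁; proj₂)
open import Data.Rational.Base as ℚ using (ℚ; 0ℚ; 1ℚ)
open import Data.Rational.Properties as ℚₚ using ()
open import Data.Unit.Base using (tt)
open import Data.Vec.Base using (Vec; []; _∷_; head; tabulate)
import Data.Vec.Functional as VF
import Data.Vec.Properties as Vecₚ
open import Function.Definitions using (Injective)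
open import Relation.Binary.Construct.Closure.ReflexiveTransitive using (Star)
open import Relation.Binary.PropositionalEquality using (_≡_; _≢_; refl; subst; sym)
open import Relation.Nullary.Decidable using (Dec; yes; no; does; _×-dec_)
open import Relation.Unary using (Decidable)

open import Algebra.Properties.CommutativeMonoid.Sum ℚₚ.+-0-commutativeMonoid
  using () renaming (sum to ∑ℚ)
open import Algebra.Properties.CommutativeMonoid.Sum +-0-commutativeMonoid
  using () renaming (sum to ∑ℕ)

-- A randomized computation: a finite tree whose internal nodes make an
-- independent, uniformly random choice among m ≥ 1 branches.
data Rand (A : Set) : Set where
  return  : A → Rand A
  uniform : (m : ℕ) .{{_ : NonZero m}} → (Fin m → Rand A) → Rand A

infixl 1 _>>=_

_>>=_ : {A B : Set} → Rand A → (A → Rand B) → Rand B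
return a    >>= g = g a
uniform m f >>= g = uniform m (λ i → f i >>= g)

Pr : {A : Set} → Rand A → {P : A → Set} → Decidable P → ℚ
Pr (return a)    P? = if does (P? a) then 1ℚ else 0ℚ
Pr (uniform m f) P? = (1ℤ ℚ./ m) ℚ.* ∑ℚ (λ i → Pr (f i) P?)

-- Since every branch has positive probability, this says that all
-- outcomes of positive probability satisfy P.
Always : {A : Set} → (A → Set) → Rand A → Set
Always P (return a)    = P a
Always P (uniform m f) = ∀ i → Always P (f i)

independently : ∀ {n} {A : Set} → (Fin n → Rand A) → Rand (Fin n → A)
independently {zero}  f = return (λ ())
independently {suc n} f = do
  a  ← f zero
  as ← independently (λ i → f (suc i))
  return (a VF.∷ as)

uniformFrom : {A : Set} → List A → Rand (Maybe A)
uniformFrom []       = return nothing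
uniformFrom (x ∷ xs) =
  uniform (suc (length xs)) (λ i → return (just (lookup (x ∷ xs) i)))

uniformFrom-∈ : {A : Set} (xs : List A) →
                Always (MaybeAll.All (_∈ˡ xs)) (uniformFrom xs)
uniformFrom-∈ []       = MaybeAll.nothing
uniformFrom-∈ (x ∷ xs) i = MaybeAll.just (∈-lookup i)

Always-map : {A : Set} {P Q : A → Set} → (∀ {a} → P a → Q a) →
             (m : Rand A) → Always P m → Always Q m
Always-map f (return a)    p = f p
Always-map f (uniform m g) p = λ i → Always-map f (g i) (p i)

record Graph (n : ℕ) : Set where
  field
    adj         : Fin n → Fin n → Bool
    symmetric   : ∀ u v → adj u v ≡ adj v u
    irreflexive : ∀ u → adj u u ≢ true
    connected   : ∀ u v → Star (λ x y → adj x y ≡ true) u v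

open Graph public

-- Rounds are counted from 0 throughout: index r stands for round r + 1.
Topology : ℕ → Set
Topology n = ℕ → Graph n

Changes : ∀ {n} → Topology n → ℕ → Set
Changes G r = ∃[ u ] ∃[ v ] adj (G r) u v ≢ adj (G (suc r)) u v

data StabilityFactor : Set where
  finite : (τ : ℕ) .{{_ : NonZero τ}} → StabilityFactor
  ∞      : StabilityFactor

Stable : ∀ {n} → StabilityFactor → Topology n → Set
Stable (finite τ) G = ∀ r r′ → r < r′ → Changes G r → Changes G r′ → r + τ ≤ r′
Stable ∞          G = ∀ r u v → adj (G r) u v ≡ adj (G (suc r)) u v

Bit : Set
Bit = Fin 2

Tag : ℕ → Set
Tag b = Vec Bit b

_≟ᵗ_ : ∀ {b} (x y : Tag b) → Dec (x ≡ y)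
_≟ᵗ_ = Vecₚ.≡-dec _≟_

-- Sets of tokens are identified with the sets of their labels in [N].
Knowledge : ℕ → ℕ → Set
Knowledge n N = Fin n → Subset N

-- What a node sees after tags are advertised: the tag of each neighbor,
-- and nothing for the nodes which are not neighbors.
View : ℕ → ℕ → Set
View b n = Fin n → Maybe (Tag b)

-- Passing from token sets Tu , Tv to Tu′ , Tv′ over one connection that
-- carries at most q tokens.
record Exchange {N} (q : ℕ) (Tu Tv Tu′ Tv′ : Subset N) : Set where
  field
    keepsˡ : Tu ⊆ Tu′
    keepsʳ : Tv ⊆ Tv′
    gainsˡ : Tu′ ⊆ Tu ∪ Tv
    gainsʳ : Tv′ ⊆ Tu ∪ Tv
    budget : ∣ Tu′ ─ Tu ∣ + ∣ Tv′ ─ Tv ∣ ≤ q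

-- What the nodes do in one round, for given shared randomness.
record RoundRule (b q n N : ℕ) : Set where
  field
    advertise : Fin n → Subset N → Tag b
    propose   : Fin n → Subset N → View b n → Rand (Maybe (Fin n))
    -- The first node is the proposer, the second the acceptor.
    interact  : (u v : Fin n) (Tu Tv : Subset N) → Rand (Subset N × Subset N)
    propose-neighbor : ∀ u T (view : View b n) →
      Always (MaybeAll.All (λ v → Is-just (view v))) (propose u T view)
    interact-exchange : ∀ u v Tu Tv →
      Always (λ (Tu′ , Tv′) → Exchange q Tu Tv Tu′ Tv′) (interact u v Tu Tv)

module _ {b q n N : ℕ} (G : Graph n) (rule : RoundRule b q n N) where
  open RoundRule rule

  viewOf : Knowledge n N → Fin n → View b n
  viewOf T u v = if adj G u v then just (advertise v (T v)) else nothing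

  -- The proposer whose proposal v accepts, if any.
  accept : (Fin n → Maybe (Fin n)) → Fin n → Rand (Maybe (Fin n))
  accept proposal v with proposal v
  ... | just _  = return nothing
  ... | nothing = uniformFrom (filter (λ u → ≡-dec _≟_ (proposal u) (just v)) (allFin n))

  connection : Knowledge n N → (Fin n → Maybe (Fin n)) → (v : Fin n) →
               Rand (Maybe (Subset N × Subset N))
  connection T accepted v with accepted v
  ... | nothing = return nothing
  ... | just u  = do
    out ← interact u v (T u) (T v)
    return (just out)

  -- outcome v is the result of the connection accepted by v, if any.
  -- Connections are disjoint, as an acceptor is never a proposer.
  update : Knowledge n N →
           (proposal accepted : Fin n → Maybe (Fin n)) →
           (outcome : Fin n → Maybe (Subset N × Subset N)) → Knowledge n N
  update T proposal accepted outcome w with proposal w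
  ... | nothing = maybe′ proj₂ (T w) (outcome w)
  ... | just v with ≡-dec _≟_ (accepted v) (just w)
  ...   | yes _ = maybe′ proj₁ (T w) (outcome v)
  ...   | no  _ = T w

  runRound : Knowledge n N → Rand (Knowledge n N)
  runRound T = do
    proposal ← independently (λ u → propose u (T u) (viewOf T u))
    accepted ← independently (accept proposal)
    outcome  ← independently (connection T accepted)
    return (update T proposal accepted outcome)

-- Each token has one initial holder; a node may hold several tokens.
record GossipInstance (n N k : ℕ) : Set where
  field
    id              : Fin n → Fin N
    id-injective    : Injective _≡_ _≡_ id
    label           : Fin k → Fin N
    label-injective : Injective _≡_ _≡_ label
    holder          : Fin k → Fin n

  initial : Knowledge n N
  initial u = tabulate λ t → does (any? λ i → (holder i ≟ u) ×-dec (label i ≟ t))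

  Solved : Knowledge n N → Set
  Solved T = ∀ u i → label i ∈ T u

  solved? : Decidable Solved
  solved? T = all? λ u → all? λ i → label i ∈? T u

-- The token sets before the first round and after each of the first r
-- rounds, most recent first.
History : ℕ → ℕ → ℕ → Set
History n N r = Vec (Knowledge n N) (suc r)

-- For each number of rounds, the law of the history of an execution.
Execution : ℕ → ℕ → Set
Execution n N = ∀ r → Rand (History n N r)

execute : ∀ {n N} → Knowledge n N →
          (∀ {r} → History n N r → Rand (Knowledge n N)) → Execution n N
execute T₀ next zero    = return (T₀ ∷ [])
execute T₀ next (suc r) = do
  h ← execute T₀ next r
  T ← next h
  return (T ∷ h)

1/_ : (n : ℕ) .{{_ : NonTrivial n}} → ℚ
1/ n = (1ℤ ℚ./ n) {{nonTrivial⇒nonZero n}}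

SolvesGossip : ∀ {n N k} .{{_ : NonTrivial n}} →
               GossipInstance n N k → Execution n N → (f : ℕ) → Set
SolvesGossip {n} I X f =
  1ℚ ℚ.- 1/ n ℚ.≤ Pr (X f) (λ h → solved? (head h))
  where open GossipInstance I

-- t is the smallest element of the symmetric difference.  Such a t
-- exists exactly when Tu ≢ Tv.
SmallestDifference : ∀ {N} → Subset N → Subset N → Fin N → Set
SmallestDifference Tu Tv t = t ∈ D × (∀ s → s ∈ D → t ≤ᶠ s)
  where D = (Tu ∪ Tv) ─ (Tu ∩ Tv)

-- The two nodes are passed to run by their IDs.  One of them knows t
-- beforehand, so t has been transferred when both know it afterwards.
record Transfer (q N : ℕ) (ε : ℚ) : Set where
  field
    run      : (idu idv : Fin N) (Tu Tv : Subset N) → Rand (Subset N × Subset N)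
    exchange : ∀ idu idv Tu Tv →
      Always (λ (Tu′ , Tv′) → Exchange q Tu Tv Tu′ Tv′) (run idu idv Tu Tv)
    transfer : ∀ idu idv Tu Tv t → SmallestDifference Tu Tv t →
      1ℚ ℚ.- ε ℚ.≤ Pr (run idu idv Tu Tv)
                      (λ out → (t ∈? proj₁ out) ×-dec (t ∈? proj₂ out))

_^-_ : (n c : ℕ) .{{_ : NonTrivial n}} → ℚ
n ^- c = (1ℤ ℚ./ (n ^ c)) {{m^n≢0 n c {{nonTrivial⇒nonZero n}}}}

-- c N² groups of N bundles of ⌈log N⌉ + 1 bits each.
SharedString : ℕ → ℕ → Set
SharedString c N = Fin (c * N ^ 2) → Fin N → Fin (suc ⌈log₂ N ⌉) → Bit

randomString : ∀ c N → Rand (SharedString c N)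
randomString c N =
  independently λ _ → independently λ _ → independently λ _ → uniform 2 return

zeroNeighbors : ∀ {n} → View 1 n → List (Fin n)
zeroNeighbors {n} view =
  filter (λ v → ≡-dec _≟ᵗ_ (view v) (just (zero ∷ []))) (allFin n)

-- The choice spelled by the trailing bits of the bundle labelled by
-- the ID of the proposer is idealized: it is a fresh draw, exactly
-- uniform on the neighbors advertising 0.
proposeFor : ∀ {n} → Bit → View 1 n → Rand (Maybe (Fin n))
proposeFor zero       view = return nothing
proposeFor (suc zero) view = uniformFrom (zeroNeighbors view)

zeroNeighbors-neighbor : ∀ {n} (view : View 1 n) {v} →
                         v ∈ˡ zeroNeighbors view → Is-just (view v)
zeroNeighbors-neighbor {n} view v∈ =
  subst Is-just (sym (proj₂ v-spec)) (is-just tt)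
  where
  v-spec = ∈-filter⁻ (λ v → ≡-dec _≟ᵗ_ (view v) (just (zero ∷ []))) {xs = allFin n} v∈

proposeFor-neighbor : ∀ {n} β (view : View 1 n) →
  Always (MaybeAll.All (λ v → Is-just (view v))) (proposeFor β view)
proposeFor-neighbor zero       view = MaybeAll.nothing
proposeFor-neighbor (suc zero) view =
  Always-map (MaybeAll.map (zeroNeighbors-neighbor view))
    (uniformFrom (zeroNeighbors view)) (uniformFrom-∈ (zeroNeighbors view))

module _ {n N k q : ℕ} {ε : ℚ} (I : GossipInstance n N k) (𝒯 : Transfer q N ε) where
  open GossipInstance I
  open Transfer 𝒯

  module _ (bundle : Fin N → Fin (suc ⌈log₂ N ⌉) → Bit) where

    tagBit : Subset N → Bit
    tagBit T = ∑ℕ (λ t → if does (t ∈? T) then toℕ (bundle t zero) else 0) mod 2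

    sharedBitRule : RoundRule 1 q n N
    sharedBitRule = record
      { advertise         = λ u T → tagBit T ∷ []
      ; propose           = λ u T view → proposeFor (tagBit T) view
      ; interact          = λ u v → run (id u) (id v)
      ; propose-neighbor  = λ u T view → proposeFor-neighbor (tagBit T) view
      ; interact-exchange = λ u v → exchange (id u) (id v)
      }

-- An arbitrary law of the next token sets given the shared string and
-- the history, governing the rounds after the shared string is used up.
Continuation : ℕ → ℕ → ℕ → Set
Continuation c n N =
  SharedString c N → ∀ {r} → History n N r → Rand (Knowledge n N)

module _ {n N k q : ℕ} {ε : ℚ} (c : ℕ) (I : GossipInstance n N k)
         (G : Topology n) (𝒯 : Transfer q N ε) (later : Continuation c n N) where
  open GossipInstance I

  sharedBitStep : SharedString c N → ∀ {r} → History n N r → Rand (Knowledge n N)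
  sharedBitStep r̂ {r} h with r <? c * N ^ 2
  ... | yes r< = runRound (G r) (sharedBitRule I 𝒯 (r̂ (fromℕ< r<))) (head h)
  ... | no  _  = later r̂ h

  sharedBit : Execution n N
  sharedBit r = do
    r̂ ← randomString c N
    execute initial (sharedBitStep r̂) r

{-# OPTIONS --safe #-}
-- Let Φ count the pairs (node, token) such that the node misses the token.
-- While gossip is unsolved, connectivity gives an edge whose ends x, y
-- differ on some token t.  The shared bit of t occurs in exactly one of the
-- two tags, so the tags differ with probability ½, whatever the other bits
-- are.  If they do, the end with tag 1 certainly proposes, so some node z
-- with tag 0 accepts a proposal; proposer and acceptor have different tags,
-- hence different token sets, and Transfer decreases Φ with probability at
-- least ½.  So W = 2^Φ, replaced by 0 once gossip is solved, satisfies
-- E W′ ≤ ⅞ W in every round.  As Φ ≤ kn initially, Markov's inequality bounds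
-- the probability of failure after 11kn rounds by (⅞¹¹ · 2)^(kn) ≤ 2^(−kn) ≤ 1/n.
module Submission where

open import Defs

module SharedBitAnalysis where

  open import Algebra.Bundles using (CommutativeRing)
  open import Data.Bool.Base using (true; false; if_then_else_)
  open import Data.Empty using (⊥)
  open import Data.Fin.Base using (Fin; zero; suc; toℕ; fromℕ<; opposite) renaming (_≤_ to _≤ᶠ_)
  open import Data.Fin.Properties using (_≟_; any?; all?; ¬∀⟶∃¬; toℕ-fromℕ<)
  open import Data.Fin.Subset using (Subset; _∈_; _∉_; _⊆_; _∪_; _∩_; _─_)
  open import Data.Fin.Subset.Properties
    using (_∈?_; ⊆-antisym; x∈p∪q⁺; x∈p∪q⁻; x∈p∩q⁺; x∈p∩q⁻; x∈p∧x∉q⇒x∈p─q; p─q⊆p)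
  open import Data.Integer.Base as ℤ using (1ℤ)
  import Data.Integer.Properties as ℤₚ
  open import Data.List.Base using (List; []; _∷_; filter; allFin)
  open import Data.List.Membership.Propositional using () renaming (_∈_ to _∈ˡ_)
  open import Data.List.Membership.Propositional.Properties using (∈-filter⁻; ∈-filter⁺; ∈-allFin; ∈-lookup)
  open import Data.Maybe.Base using (Maybe; just; nothing; maybe′)
  open import Data.Maybe.Properties using (≡-dec; just-injective)
  open import Data.Maybe.Relation.Unary.All as MaybeAll using (just; nothing)
  open import Data.Nat.Base as ℕ using (ℕ; zero; suc; z≤n; s≤s; NonZero; NonTrivial; nonTrivial⇒nonZero)
  open import Data.Nat.DivMod using (_mod_)
  open import Data.Nat.Logarithm using (⌈log₂_⌉)
  import Data.Nat.Properties as ℕₚ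
  open import Data.Product.Base using (∃; ∃-syntax; _×_; _,_; proj₁; proj₂)
  open import Data.Rational.Base
    using (ℚ; 0ℚ; 1ℚ; ½; _+_; _*_; -_; _-_; _/_; _≤_; toℚᵘ; NonNegative; NonPositive; nonNegative)
  open import Data.Rational.Properties hiding (_≟_; _≤?_)
  import Data.Rational.Solver
  open import Data.Rational.Unnormalised.Base using (mkℚᵘ; *≡*; *≤*)
  import Data.Rational.Unnormalised.Properties as ℚᵘₚ
  open import Data.Sum.Base using (_⊎_; inj₁; inj₂; [_,_]′)
  open import Data.Unit.Base using (⊤; tt)
  open import Data.Vec.Base using (_∷_; []; head; there)
  open import Data.Vec.Functional using (Vector)
  import Data.Vec.Functional as VF
  import Data.Vec.Functional.Properties as VFₚ
  import Data.Vec.Properties as Vecₚ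
  open import Function.Base using (_∘_; const; _$_)
  open import Relation.Binary.Construct.Closure.ReflexiveTransitive using (Star; _◅_) renaming (ε to stop)
  open import Relation.Binary.PropositionalEquality
  open import Relation.Nullary.Decidable using (Dec; does; yes; no; _×-dec_; dec-true; dec-false)
  open import Relation.Nullary.Negation using (¬_; contradiction)
  open import Relation.Unary using (Decidable)

  private
    ℚ-semiring = CommutativeRing.semiring +-*-commutativeRing

  open import Algebra.Properties.CommutativeMonoid.Sum ℕₚ.+-0-commutativeMonoid
    using () renaming (sum to ∑ℕ; sum-cong-≗ to ∑ℕ-cong)
  open import Algebra.Properties.CommutativeSemiring.Exp (CommutativeRing.commutativeSemiring +-*-commutativeRing)
    using (^-distrib-*)
  open import Algebra.Properties.Monoid.Mult +-0-monoid using () renaming (_×_ to _⨯_)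
  open import Algebra.Properties.Semiring.Exp ℚ-semiring using (_^_; ^-assocʳ)
  open import Algebra.Properties.Semiring.Sum ℚ-semiring
    using (sum; sum-cong-≗; ∑-distrib-+; *-distribˡ-sum; sum-replicate)

  -- Averages of rational constants.

  -- `_/_` divides by a gcd and is stuck on a variable `m`, so the identity is verified on
  -- unnormalised rationals by cross-multiplication.
  ⨯1≡/1 : ∀ m → m ⨯ 1ℚ ≡ ℤ.+ m / 1
  ⨯1≡/1 zero    = refl
  ⨯1≡/1 (suc m) = trans (cong (1ℚ +_) (⨯1≡/1 m)) (toℚᵘ-injective
    (ℚᵘₚ.≃-trans (toℚᵘ-homo-+ 1ℚ (ℤ.+ m / 1))
    (ℚᵘₚ.≃-trans (ℚᵘₚ.+-congʳ (toℚᵘ 1ℚ) (toℚᵘ-fromℚᵘ (mkℚᵘ (ℤ.+ m) 0)))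
    (ℚᵘₚ.≃-trans (*≡* (cong (λ z → (ℤ.+ 1 ℤ.+ z) ℤ.* ℤ.+ 1) (ℤₚ.*-identityʳ (ℤ.+ m))))
    (ℚᵘₚ.≃-sym (toℚᵘ-fromℚᵘ (mkℚᵘ (ℤ.+ suc m) 0)))))))

  1/m*m⨯1≡1 : ∀ m .{{_ : NonZero m}} → (1ℤ / m) * (m ⨯ 1ℚ) ≡ 1ℚ
  1/m*m⨯1≡1 (suc d) = trans (cong ((1ℤ / suc d) *_) (⨯1≡/1 (suc d))) (toℚᵘ-injective
    (ℚᵘₚ.≃-trans (toℚᵘ-homo-* (1ℤ / suc d) (ℤ.+ suc d / 1))
    (ℚᵘₚ.≃-trans (ℚᵘₚ.*-cong (toℚᵘ-fromℚᵘ (mkℚᵘ 1ℤ d)) (toℚᵘ-fromℚᵘ (mkℚᵘ (ℤ.+ suc d) 0)))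
    (*≡* (trans (ℤₚ.*-identityʳ _) (cong (λ z → 1ℤ ℤ.* ℤ.+ z) (sym (ℕₚ.*-identityʳ (suc d)))))))))

  ⨯≡⨯1* : ∀ m c → m ⨯ c ≡ (m ⨯ 1ℚ) * c
  ⨯≡⨯1* zero    c = sym (*-zeroˡ c)
  ⨯≡⨯1* (suc m) c = begin
    c + m ⨯ c                 ≡⟨ cong₂ _+_ (sym (*-identityˡ c)) (⨯≡⨯1* m c) ⟩
    1ℚ * c + (m ⨯ 1ℚ) * c     ≡⟨ *-distribʳ-+ c 1ℚ (m ⨯ 1ℚ) ⟨
    (1ℚ + m ⨯ 1ℚ) * c         ∎
    where open ≡-Reasoning

  1/m-nonNegative : ∀ m .{{_ : NonZero m}} → NonNegative (1ℤ / m)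
  1/m-nonNegative m = normalize-nonNeg 1 m

  average-const : ∀ m .{{_ : NonZero m}} c → (1ℤ / m) * sum {m} (const c) ≡ c
  average-const m c = begin
    (1ℤ / m) * sum {m} (const c)     ≡⟨ cong ((1ℤ / m) *_) (sum-replicate m) ⟩
    (1ℤ / m) * (m ⨯ c)               ≡⟨ cong ((1ℤ / m) *_) (⨯≡⨯1* m c) ⟩
    (1ℤ / m) * ((m ⨯ 1ℚ) * c)        ≡⟨ *-assoc (1ℤ / m) (m ⨯ 1ℚ) c ⟨
    (1ℤ / m) * (m ⨯ 1ℚ) * c          ≡⟨ cong (_* c) (1/m*m⨯1≡1 m) ⟩
    1ℚ * c                           ≡⟨ *-identityˡ c ⟩
    c                                ∎
    where open ≡-Reasoning

  sum-mono-≤ : ∀ {m} {f g : Vector ℚ m} → (∀ i → f i ≤ g i) → sum f ≤ sum g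
  sum-mono-≤ {zero}  f≤g = ≤-refl
  sum-mono-≤ {suc m} f≤g = +-mono-≤ (f≤g zero) (sum-mono-≤ (f≤g ∘ suc))

  -- Expectation over choice trees.

  E : {A : Set} → Rand A → (A → ℚ) → ℚ
  E (return a)    f = f a
  E (uniform m g) f = (1ℤ / m) * sum (λ i → E (g i) f)

  private variable
    A B : Set

  E-cong : ∀ (M : Rand A) {f g} → (∀ a → f a ≡ g a) → E M f ≡ E M g
  E-cong (return a)    f≗g = f≗g a
  E-cong (uniform m h) f≗g = cong ((1ℤ / m) *_) (sum-cong-≗ λ i → E-cong (h i) f≗g)

  -- The inequality is required only on outcomes that can occur, so invariants of the support, such
  -- as `Outcome`, `Proposal` or `Consistent`, can feed into estimates.
  E-mono-≤ : ∀ (M : Rand A) {f g} → Always (λ a → f a ≤ g a) M → E M f ≤ E M g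
  E-mono-≤ (return a)    f≤g = f≤g
  E-mono-≤ (uniform m h) f≤g =
    *-monoˡ-≤-nonNeg (1ℤ / m) {{1/m-nonNegative m}} (sum-mono-≤ λ i → E-mono-≤ (h i) (f≤g i))

  E-const : ∀ (M : Rand A) c → E M (const c) ≡ c
  E-const (return a)    c = refl
  E-const (uniform m h) c =
    trans (cong ((1ℤ / m) *_) (sum-cong-≗ λ i → E-const (h i) c)) (average-const m c)

  E-* : ∀ (M : Rand A) c f → E M (λ a → c * f a) ≡ c * E M f
  E-* (return a)    c f = refl
  E-* (uniform m h) c f = begin
    p * sum (λ i → E (h i) (λ a → c * f a))   ≡⟨ cong (p *_) (sum-cong-≗ λ i → E-* (h i) c f) ⟩
    p * sum (λ i → c * E (h i) f)             ≡⟨ cong (p *_) (*-distribˡ-sum c (λ i → E (h i) f)) ⟨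
    p * (c * sum (λ i → E (h i) f))           ≡⟨ *-assoc p c _ ⟨
    p * c * sum (λ i → E (h i) f)             ≡⟨ cong (_* sum (λ i → E (h i) f)) (*-comm p c) ⟩
    c * p * sum (λ i → E (h i) f)             ≡⟨ *-assoc c p _ ⟩
    c * (p * sum (λ i → E (h i) f))           ∎
    where
    open ≡-Reasoning
    p = 1ℤ / m

  E-+ : ∀ (M : Rand A) f g → E M (λ a → f a + g a) ≡ E M f + E M g
  E-+ (return a)    f g = refl
  E-+ (uniform m h) f g = begin
    p * sum (λ i → E (h i) (λ a → f a + g a))                ≡⟨ cong (p *_) (sum-cong-≗ λ i → E-+ (h i) f g) ⟩
    p * sum (λ i → E (h i) f + E (h i) g)                    ≡⟨ cong (p *_) (∑-distrib-+ (λ i → E (h i) f) (λ i → E (h i) g)) ⟩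
    p * (sum (λ i → E (h i) f) + sum (λ i → E (h i) g))      ≡⟨ *-distribˡ-+ p _ _ ⟩
    p * sum (λ i → E (h i) f) + p * sum (λ i → E (h i) g)    ∎
    where
    open ≡-Reasoning
    p = 1ℤ / m

  E-sum : ∀ (M : Rand A) {m} (f : Fin m → A → ℚ) → E M (λ a → sum (λ i → f i a)) ≡ sum (λ i → E M (f i))
  E-sum M {zero}  f = E-const M 0ℚ
  E-sum M {suc m} f =
    trans (E-+ M (f zero) (λ a → sum (λ i → f (suc i) a))) (cong (E M (f zero) +_) (E-sum M (f ∘ suc)))

  E->>= : ∀ (M : Rand A) (g : A → Rand B) f → E (M >>= g) f ≡ E M (λ a → E (g a) f)
  E->>= (return a)    g f = refl
  E->>= (uniform m h) g f = cong ((1ℤ / m) *_) (sum-cong-≗ λ i → E->>= (h i) g f)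

  -- Fubini for finite trees. It lets the shared bits of a round be averaged after the history has
  -- been fixed.
  E-swap : ∀ (M : Rand A) (M′ : Rand B) (f : A → B → ℚ) →
           E M (λ a → E M′ (f a)) ≡ E M′ (λ b → E M (λ a → f a b))
  E-swap (return a)    M′ f = refl
  E-swap (uniform m h) M′ f = begin
    p * sum (λ i → E (h i) (λ a → E M′ (f a)))            ≡⟨ cong (p *_) (sum-cong-≗ λ i → E-swap (h i) M′ f) ⟩
    p * sum (λ i → E M′ (λ b → E (h i) (λ a → f a b)))    ≡⟨ cong (p *_) (E-sum M′ (λ i b → E (h i) (λ a → f a b))) ⟨
    p * E M′ (λ b → sum (λ i → E (h i) (λ a → f a b)))    ≡⟨ E-* M′ p _ ⟨
    E M′ (λ b → p * sum (λ i → E (h i) (λ a → f a b)))    ∎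
    where
    open ≡-Reasoning
    p = 1ℤ / m

  𝟙 : {P : A → Set} → Decidable P → A → ℚ
  𝟙 P? a = if does (P? a) then 1ℚ else 0ℚ

  𝟙-true : ∀ {P : A → Set} (P? : Decidable P) {a} → P a → 𝟙 P? a ≡ 1ℚ
  𝟙-true P? {a} p rewrite dec-true (P? a) p = refl

  𝟙-false : ∀ {P : A → Set} (P? : Decidable P) {a} → ¬ P a → 𝟙 P? a ≡ 0ℚ
  𝟙-false P? {a} ¬p rewrite dec-false (P? a) ¬p = refl

  Pr≡E𝟙 : ∀ (M : Rand A) {P : A → Set} (P? : Decidable P) → Pr M P? ≡ E M (𝟙 P?)
  Pr≡E𝟙 (return a)    P? = refl
  Pr≡E𝟙 (uniform m h) P? = cong ((1ℤ / m) *_) (sum-cong-≗ λ i → Pr≡E𝟙 (h i) P?)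

  always : {P : A → Set} → (∀ a → P a) → ∀ M → Always P M
  always p (return a)    = p a
  always p (uniform m h) i = always p (h i)

  Always->>= : ∀ {P : A → Set} {Q : B → Set} (M : Rand A) (g : A → Rand B) →
               Always P M → (∀ a → P a → Always Q (g a)) → Always Q (M >>= g)
  Always->>= (return a)    g p q = q a p
  Always->>= (uniform m h) g p q i = Always->>= (h i) g (p i) q

  Always-independently : ∀ {n} {P : Fin n → A → Set} (M : Fin n → Rand A) →
    (∀ i → Always (P i) (M i)) → Always (λ g → ∀ i → P i (g i)) (independently M)
  Always-independently {n = zero}  M p = λ ()
  Always-independently {n = suc n} M p =
    Always->>= (M zero) _ (p zero) λ a pa →
    Always->>= (independently (M ∘ suc)) _ (Always-independently (M ∘ suc) (p ∘ suc)) λ as pas →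
    λ { zero → pa ; (suc i) → pas i }

  E-independently-suc : ∀ {n} (M : Fin (suc n) → Rand A) f →
    E (independently M) f ≡ E (M zero) (λ a → E (independently (M ∘ suc)) (λ as → f (a VF.∷ as)))
  E-independently-suc M f = trans
    (E->>= (M zero) _ f)
    (E-cong (M zero) λ a → E->>= (independently (M ∘ suc)) (λ as → return (a VF.∷ as)) f)

  -- Coordinate i may be redrawn: F sees it only through its second argument.
  E-redraw : ∀ {n} (M : Fin n → Rand A) i (F : (Fin n → A) → A → ℚ) →
    (∀ g g′ b → (∀ j → j ≢ i → g j ≡ g′ j) → F g b ≡ F g′ b) →
    E (independently M) (λ g → F g (g i)) ≡ E (independently M) (λ g → E (M i) (F g))
  E-redraw {n = suc n} M zero F F-cong = begin
    E (independently M) (λ g → F g (g zero))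
      ≡⟨ E-independently-suc M _ ⟩
    E (M zero) (λ a → E rest (λ as → F (a VF.∷ as) a))
      -- A dummy draw `a′` of the same coordinate is added. It becomes the entry that `F` ignores,
      -- while `a` takes the role of the fresh draw.
      ≡⟨ E-const (M zero) _ ⟨
    E (M zero) (λ a′ → E (M zero) (λ a → E rest (λ as → F (a VF.∷ as) a)))
      ≡⟨ E-cong (M zero) (λ a′ → E-swap (M zero) rest (λ a as → F (a VF.∷ as) a)) ⟩
    E (M zero) (λ a′ → E rest (λ as → E (M zero) (λ a → F (a VF.∷ as) a)))
      ≡⟨ E-cong (M zero) (λ a′ → E-cong rest λ as → E-cong (M zero) λ a →
           F-cong (a VF.∷ as) (a′ VF.∷ as) a λ { zero 0≢0 → contradiction refl 0≢0 ; (suc j) _ → refl }) ⟩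
    E (M zero) (λ a′ → E rest (λ as → E (M zero) (F (a′ VF.∷ as))))
      ≡⟨ E-independently-suc M _ ⟨
    E (independently M) (λ g → E (M zero) (F g)) ∎
    where
    open ≡-Reasoning
    rest = independently (M ∘ suc)
  E-redraw {n = suc n} M (suc i) F F-cong = begin
    E (independently M) (λ g → F g (g (suc i)))
      ≡⟨ E-independently-suc M _ ⟩
    E (M zero) (λ a → E rest (λ as → F (a VF.∷ as) (as i)))
      ≡⟨ E-cong (M zero) (λ a → E-redraw (M ∘ suc) i (λ as → F (a VF.∷ as)) λ g g′ b g≗g′ →
           F-cong (a VF.∷ g) (a VF.∷ g′) b λ { zero _ → refl ; (suc j) j≢i → g≗g′ j (j≢i ∘ cong suc) }) ⟩
    E (M zero) (λ a → E rest (λ as → E (M (suc i)) (F (a VF.∷ as))))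
      ≡⟨ E-independently-suc M _ ⟨
    E (independently M) (λ g → E (M (suc i)) (F g)) ∎
    where
    open ≡-Reasoning
    rest = independently (M ∘ suc)

  -- Redrawing coordinate `i` for an integrand that ignores all others leaves an expectation that is
  -- constant in the tuple.
  E-marginal : ∀ {n} (M : Fin n → Rand A) i (f : A → ℚ) →
    E (independently M) (λ g → f (g i)) ≡ E (M i) f
  E-marginal M i f = trans (E-redraw M i (λ _ → f) λ _ _ _ _ → refl) (E-const (independently M) _)

  -- Constants, sums of naturals and powers.

  -- `¾` is the drift factor of `W` in a round where the two tags differ: with probability at least
  -- ½ it halves. Averaging `¾` and 1 over a fair bit gives `⅞`.
  ¾ ⅞ 2ℚ : ℚ
  ¾ = ℤ.+ 3 / 4
  ⅞ = ℤ.+ 7 / 8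
  2ℚ = ℤ.+ 2 / 1

  ∑ℕ-mono-≤ : ∀ {m} {f g : Vector ℕ m} → (∀ i → f i ℕ.≤ g i) → ∑ℕ f ℕ.≤ ∑ℕ g
  ∑ℕ-mono-≤ {zero}  f≤g = z≤n
  ∑ℕ-mono-≤ {suc m} f≤g = ℕₚ.+-mono-≤ (f≤g zero) (∑ℕ-mono-≤ (f≤g ∘ suc))

  ∑ℕ-mono-< : ∀ {m} {f g : Vector ℕ m} → (∀ i → f i ℕ.≤ g i) → ∀ i → f i ℕ.< g i → ∑ℕ f ℕ.< ∑ℕ g
  ∑ℕ-mono-< f≤g zero    fi<gi = ℕₚ.+-mono-<-≤ fi<gi (∑ℕ-mono-≤ (f≤g ∘ suc))
  ∑ℕ-mono-< f≤g (suc i) fi<gi = ℕₚ.+-mono-≤-< (f≤g zero) (∑ℕ-mono-< (f≤g ∘ suc) i fi<gi)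

  ∑ℕ-≤-* : ∀ {m} {f : Vector ℕ m} {c} → (∀ i → f i ℕ.≤ c) → ∑ℕ f ℕ.≤ m ℕ.* c
  ∑ℕ-≤-* {zero}  f≤c = z≤n
  ∑ℕ-≤-* {suc m} f≤c = ℕₚ.+-mono-≤ (f≤c zero) (∑ℕ-≤-* (f≤c ∘ suc))

  1≤p⇒1≤p^m : ∀ {p} → 1ℚ ≤ p → ∀ m → 1ℚ ≤ p ^ m
  1≤p⇒1≤p^m         1≤p zero    = ≤-refl
  1≤p⇒1≤p^m {p} 1≤p (suc m) = begin
    1ℚ            ≤⟨ 1≤p⇒1≤p^m 1≤p m ⟩
    p ^ m         ≡⟨ *-identityˡ (p ^ m) ⟨
    1ℚ * p ^ m    ≤⟨ *-monoʳ-≤-nonNeg (p ^ m) {{nonNegative (≤-trans (nonNegative⁻¹ 1ℚ) (1≤p⇒1≤p^m 1≤p m))}} 1≤p ⟩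
    p * p ^ m     ∎
    where open ≤-Reasoning

  ^-nonNeg : ∀ p .{{_ : NonNegative p}} m → NonNegative (p ^ m)
  ^-nonNeg p zero    = _
  ^-nonNeg p (suc m) = nonNeg*nonNeg⇒nonNeg p (p ^ m) {{^-nonNeg p m}}

  ^-monoʳ-≤ : ∀ {p} → 1ℚ ≤ p → ∀ {m m′} → m ℕ.≤ m′ → p ^ m ≤ p ^ m′
  ^-monoʳ-≤     1≤p {m′ = m′} z≤n         = 1≤p⇒1≤p^m 1≤p m′
  ^-monoʳ-≤ {p} 1≤p           (s≤s m≤m′) =
    *-monoˡ-≤-nonNeg p {{nonNegative (≤-trans (nonNegative⁻¹ 1ℚ) 1≤p)}} (^-monoʳ-≤ 1≤p m≤m′)

  1≤2ℚ : 1ℚ ≤ 2ℚ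
  1≤2ℚ = ≤ᵇ⇒≤ _

  -- Smallest differences of token sets and uniform choices from lists.

  least : ∀ {m} {P : Fin m → Set} → Decidable P → ∃ P → ∃[ i ] P i × (∀ j → P j → i ≤ᶠ j)
  least {suc m} P? (i , pi) with P? zero
  ... | yes p₀ = zero , p₀ , λ _ _ → z≤n
  least {suc m} P? (zero  , pi) | no ¬p₀ = contradiction pi ¬p₀
  least {suc m} P? (suc i , pi) | no ¬p₀ with least (P? ∘ suc) (i , pi)
  ... | j , pj , j-least = suc j , pj , λ { zero p₀ → contradiction p₀ ¬p₀ ; (suc j′) pj′ → s≤s (j-least j′ pj′) }

  x∈p─q⇒x∉q : ∀ {m} {p q : Subset m} {x} → x ∈ p ─ q → x ∉ q
  x∈p─q⇒x∉q {p = _ ∷ _} {true  ∷ _} {suc x} (there x∈p─q) (there x∈q) = x∈p─q⇒x∉q x∈p─q x∈q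
  x∈p─q⇒x∉q {p = _ ∷ _} {false ∷ _} {suc x} (there x∈p─q) (there x∈q) = x∈p─q⇒x∉q x∈p─q x∈q

  -- Were the symmetric difference empty, each set would contain the other.
  smallestDifference : ∀ {N} (S S′ : Subset N) → S ≢ S′ → ∃ (SmallestDifference S S′)
  smallestDifference S S′ S≢S′ with any? (_∈? ((S ∪ S′) ─ (S ∩ S′)))
  ... | yes ∃t = least (_∈? ((S ∪ S′) ─ (S ∩ S′))) ∃t
  ... | no ∄t = contradiction (⊆-antisym (λ {t} → S⊆S′ {t}) (λ {t} → S′⊆S {t})) S≢S′
    where
    S⊆S′ : S ⊆ S′
    S⊆S′ {t} t∈S with t ∈? S′
    ... | yes t∈S′ = t∈S′
    ... | no t∉S′ = contradiction
      (t , x∈p∧x∉q⇒x∈p─q (x∈p∪q⁺ (inj₁ t∈S)) (t∉S′ ∘ proj₂ ∘ x∈p∩q⁻ S S′)) ∄t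
    S′⊆S : S′ ⊆ S
    S′⊆S {t} t∈S′ with t ∈? S
    ... | yes t∈S = t∈S
    ... | no t∉S = contradiction
      (t , x∈p∧x∉q⇒x∈p─q (x∈p∪q⁺ (inj₂ t∈S′)) (t∉S ∘ proj₁ ∘ x∈p∩q⁻ S S′)) ∄t

  uniformFrom-spec : {A : Set} (xs : List A) →
    Always (λ a → (∃[ x ] a ≡ just x × x ∈ˡ xs) ⊎ (a ≡ nothing × xs ≡ [])) (uniformFrom xs)
  uniformFrom-spec []       = inj₂ (refl , refl)
  uniformFrom-spec (x ∷ xs) i = inj₁ (_ , refl , ∈-lookup i)

  -- One round of an arbitrary rule.

  -- `gains` forgets which node supplied a token; this suffices to show that every token in
  -- circulation is one of the `k` given ones.
  record Evolves {n N} (T T′ : Knowledge n N) : Set where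
    field
      keeps : ∀ w → T w ⊆ T′ w
      gains : ∀ w {t} → t ∈ T′ w → ∃[ x ] t ∈ T x

  open Evolves

  module _ {b q n N : ℕ} (G : Graph n) (rule : RoundRule b q n N) where
    open RoundRule rule

    -- The witness `u` records whose proposal was accepted, so that the exchange can later be
    -- matched with the proposer.
    Outcome : Knowledge n N → Maybe (Fin n) → Fin n → Maybe (Subset N × Subset N) → Set
    Outcome T acc v = MaybeAll.All (λ (Tu′ , Tv′) → ∃[ u ] acc ≡ just u × Exchange q (T u) (T v) Tu′ Tv′)

    connection-outcome : ∀ T accepted v → Always (Outcome T (accepted v) v) (connection G rule T accepted v)
    connection-outcome T accepted v with accepted v
    ... | nothing = nothing
    ... | just u  = Always->>= (interact u v (T u) (T v)) _ (interact-exchange u v (T u) (T v))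
                      λ out e → just (u , refl , e)

    E-connection : ∀ T accepted {u v} → accepted v ≡ just u → ∀ f →
      E (connection G rule T accepted v) f ≡ E (interact u v (T u) (T v)) (f ∘ just)
    E-connection T accepted {v = v} av f with accepted v
    E-connection T accepted {v = v} refl f | just u = E->>= (interact u v (T u) (T v)) (return ∘ just) f

    update-evolves : ∀ T proposal accepted outcome → (∀ v → Outcome T (accepted v) v (outcome v)) →
                     Evolves T (update G rule T proposal accepted outcome)
    update-evolves T proposal accepted outcome ok = record { keeps = λ w → proj₁ (at w) ; gains = λ w → proj₂ (at w) }
      where
      at : ∀ w → (T w ⊆ update G rule T proposal accepted outcome w) ×
                 (∀ {t} → t ∈ update G rule T proposal accepted outcome w → ∃[ x ] t ∈ T x)
      at w with proposal w
      at w | nothing with outcome w | ok w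
      ... | nothing | _ = (λ z → z) , (w ,_)
      ... | just (Tu′ , Tw′) | just (u , _ , e) =
        Exchange.keepsʳ e , λ t∈ → [ u ,_ , w ,_ ]′ (x∈p∪q⁻ (T u) (T w) (Exchange.gainsʳ e t∈))
      at w | just v with ≡-dec _≟_ (accepted v) (just w)
      ... | no _ = (λ z → z) , (w ,_)
      ... | yes a with outcome v | ok v
      ...   | nothing | _ = (λ z → z) , (w ,_)
      -- `w` and the recorded `u` are both the value of `accepted v`, hence equal, and the exchange
      -- is one between `w` and `v`.
      ...   | just (Tu′ , Tv′) | just (u , a′ , e) with just-injective (trans (sym a) a′)
      ...     | refl = Exchange.keepsˡ e , λ t∈ → [ w ,_ , v ,_ ]′ (x∈p∪q⁻ (T w) (T v) (Exchange.gainsˡ e t∈))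

    update-acceptor : ∀ T proposal accepted outcome {z} → proposal z ≡ nothing →
      update G rule T proposal accepted outcome z ≡ maybe′ proj₂ (T z) (outcome z)
    update-acceptor T proposal accepted outcome {z} pz with proposal z
    ... | nothing = refl

    update-proposer : ∀ T proposal accepted outcome {w z} → proposal w ≡ just z → accepted z ≡ just w →
      update G rule T proposal accepted outcome w ≡ maybe′ proj₁ (T w) (outcome z)
    update-proposer T proposal accepted outcome {w} {z} pw az with proposal w
    update-proposer T proposal accepted outcome {w} {z} refl az | just z with ≡-dec _≟_ (accepted z) (just w)
    ... | yes _  = refl
    ... | no  ¬a = contradiction az ¬a

    proposals : Knowledge n N → Rand (Fin n → Maybe (Fin n))
    proposals T = independently (λ u → propose u (T u) (viewOf G rule T u))

    acceptances : (Fin n → Maybe (Fin n)) → Rand (Fin n → Maybe (Fin n))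
    acceptances proposal = independently (accept G rule proposal)

    outcomes : Knowledge n N → (Fin n → Maybe (Fin n)) → Rand (Fin n → Maybe (Subset N × Subset N))
    outcomes T accepted = independently (connection G rule T accepted)

    -- Growth holds whatever is proposed and accepted, so the first two draws carry a trivial
    -- predicate and only the outcomes carry information.
    runRound-evolves : ∀ T → Always (Evolves T) (runRound G rule T)
    runRound-evolves T =
      Always->>= {P = const ⊤} (proposals T) _ (always (λ _ → tt) (proposals T)) λ proposal _ →
      Always->>= {P = const ⊤} (acceptances proposal) _ (always (λ _ → tt) (acceptances proposal)) λ accepted _ →
      Always->>= (outcomes T accepted) _ (Always-independently _ (connection-outcome T accepted)) λ outcome ok →
      update-evolves T proposal accepted outcome ok

    E-runRound : ∀ T f → E (runRound G rule T) f ≡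
      E (proposals T) (λ proposal →
      E (acceptances proposal) (λ accepted →
      E (outcomes T accepted) (λ outcome →
      f (update G rule T proposal accepted outcome))))
    E-runRound T f =
      trans (E->>= (proposals T) (λ proposal → acceptances proposal >>= after proposal) f) $
      E-cong (proposals T) λ proposal →
      trans (E->>= (acceptances proposal) (after proposal) f) $
      E-cong (acceptances proposal) λ accepted →
      E->>= (outcomes T accepted) (λ outcome → return (update G rule T proposal accepted outcome)) f
      where
      after : (proposal accepted : Fin n → Maybe (Fin n)) → Rand (Knowledge n N)
      after proposal accepted =
        outcomes T accepted >>= λ outcome → return (update G rule T proposal accepted outcome)

    -- The proposal of `x` makes the list of proposers nonempty, so the uniform choice cannot return
    -- `nothing`. The chosen `w` need not be `x`.
    acceptor-accepts : ∀ proposal {x z} → proposal z ≡ nothing → proposal x ≡ just z →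
      Always (λ a → ∃[ w ] a ≡ just w × proposal w ≡ just z) (accept G rule proposal z)
    acceptor-accepts proposal {x} {z} pz px with proposal z
    ... | nothing = Always-map
      (λ { (inj₁ (w , eq , w∈)) → w , eq , proj₂ (∈-filter⁻ proposes? {xs = allFin n} w∈)
         ; (inj₂ (_ , none)) → contradiction (subst (x ∈ˡ_) none (∈-filter⁺ proposes? (∈-allFin x) px)) λ () })
      (uniformFrom (filter proposes? (allFin n))) (uniformFrom-spec (filter proposes? (allFin n)))
      where proposes? = λ u → ≡-dec _≟_ (proposal u) (just z)

  -- The potential W.

  module Potential {n N k : ℕ} (I : GossipInstance n N k) where
    open GossipInstance I

    missing : Knowledge n N → Fin n → Fin k → ℕ
    missing T u i = if does (label i ∈? T u) then 0 else 1

    Φ : Knowledge n N → ℕ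
    Φ T = ∑ℕ λ u → ∑ℕ λ i → missing T u i

    W : Knowledge n N → ℚ
    W T = if does (solved? T) then 0ℚ else 2ℚ ^ Φ T

    missing-≤1 : ∀ T u i → missing T u i ℕ.≤ 1
    missing-≤1 T u i with does (label i ∈? T u)
    ... | true  = z≤n
    ... | false = ℕₚ.≤-refl

    Φ-≤ : ∀ T → Φ T ℕ.≤ k ℕ.* n
    Φ-≤ T = ℕₚ.≤-trans (∑ℕ-≤-* λ u → ∑ℕ-≤-* (missing-≤1 T u))
      (ℕₚ.≤-reflexive (trans (cong (n ℕ.*_) (ℕₚ.*-identityʳ k)) (ℕₚ.*-comm n k)))

    module _ {T T′ : Knowledge n N} (T⊆T′ : ∀ w → T w ⊆ T′ w) where

      missing-mono : ∀ u i → missing T′ u i ℕ.≤ missing T u i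
      missing-mono u i with label i ∈? T u | label i ∈? T′ u
      ... | _      | yes _ = z≤n
      ... | no  _  | no  _ = ℕₚ.≤-refl
      ... | yes t∈ | no t∉ = contradiction (T⊆T′ u t∈) t∉

      Φ-mono : Φ T′ ℕ.≤ Φ T
      Φ-mono = ∑ℕ-mono-≤ λ u → ∑ℕ-mono-≤ (missing-mono u)

      Φ-mono-< : ∀ {u i} → label i ∉ T u → label i ∈ T′ u → Φ T′ ℕ.< Φ T
      Φ-mono-< {u} {i} t∉ t∈ =
        ∑ℕ-mono-< (λ u → ∑ℕ-mono-≤ (missing-mono u)) u (∑ℕ-mono-< (missing-mono u) i missing-<)
        where
        missing-< : missing T′ u i ℕ.< missing T u i
        missing-< rewrite dec-true (label i ∈? T′ u) t∈ | dec-false (label i ∈? T u) t∉ = ℕₚ.≤-refl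

    0≤W : ∀ T → 0ℚ ≤ W T
    0≤W T with does (solved? T)
    ... | true  = ≤-refl
    ... | false = nonNegative⁻¹ (2ℚ ^ Φ T) {{^-nonNeg 2ℚ (Φ T)}}

    W-≤ : ∀ T → W T ≤ 2ℚ ^ Φ T
    W-≤ T with does (solved? T)
    ... | true  = nonNegative⁻¹ (2ℚ ^ Φ T) {{^-nonNeg 2ℚ (Φ T)}}
    ... | false = ≤-refl

    W-solved : ∀ {T} → Solved T → W T ≡ 0ℚ
    W-solved {T} s rewrite dec-true (solved? T) s = refl

    W-unsolved : ∀ {T} → ¬ Solved T → W T ≡ 2ℚ ^ Φ T
    W-unsolved {T} ¬s rewrite dec-false (solved? T) ¬s = refl

    -- A solved state stays solved as knowledge grows, so the drop to 0 is never undone; otherwise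
    -- `Φ` can only fall.
    W-mono : ∀ {T T′} → (∀ w → T w ⊆ T′ w) → W T′ ≤ W T
    W-mono {T} {T′} T⊆T′ with solved? T
    ... | yes s = ≤-trans (≤-reflexive (W-solved {T′} λ u i → T⊆T′ u (s u i))) (0≤W T)
    ... | no ¬s = ≤-trans (W-≤ T′)
      (≤-trans (^-monoʳ-≤ 1≤2ℚ (Φ-mono T⊆T′)) (≤-reflexive (sym (W-unsolved {T} ¬s))))

    -- The gained token lowers `Φ` by at least one. The missing one shows that `T` is unsolved, so
    -- `W T` is the full power of two; `T′` may be solved, which only helps.
    W-halves : ∀ {T T′ u i} → (∀ w → T w ⊆ T′ w) → label i ∉ T u → label i ∈ T′ u → W T′ ≤ ½ * W T
    W-halves {T} {T′} {u} {i} T⊆T′ t∉ t∈ = begin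
      W T′                       ≤⟨ W-≤ T′ ⟩
      2ℚ ^ Φ T′                  ≡⟨ *-identityˡ (2ℚ ^ Φ T′) ⟨
      (½ * 2ℚ) * 2ℚ ^ Φ T′       ≡⟨ *-assoc ½ 2ℚ (2ℚ ^ Φ T′) ⟩
      ½ * 2ℚ ^ suc (Φ T′)        ≤⟨ *-monoˡ-≤-nonNeg ½ (^-monoʳ-≤ 1≤2ℚ (Φ-mono-< T⊆T′ t∉ t∈)) ⟩
      ½ * 2ℚ ^ Φ T               ≡⟨ cong (½ *_) (W-unsolved {T} λ s → t∉ (s u i)) ⟨
      ½ * W T                    ∎
      where open ≤-Reasoning

  -- Parity under one changed bit, and boundary edges.

  ∑ℕ-suc : ∀ {m} (f g : Vector ℕ m) i → g i ≡ suc (f i) → (∀ j → j ≢ i → g j ≡ f j) → ∑ℕ g ≡ suc (∑ℕ f)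
  ∑ℕ-suc {suc m} f g zero    gi≡ g≗f = cong₂ ℕ._+_ gi≡ (∑ℕ-cong λ j → g≗f (suc j) λ ())
  ∑ℕ-suc {suc m} f g (suc i) gi≡ g≗f = trans
    (cong₂ ℕ._+_ (g≗f zero λ ()) (∑ℕ-suc (f ∘ suc) (g ∘ suc) i gi≡ λ j j≢i → g≗f (suc j) λ { refl → j≢i refl }))
    (ℕₚ.+-suc (f zero) (∑ℕ (f ∘ suc)))

  -- On `Fin 2`, `opposite` is the complement of a bit. Two successors cancel by computation, which
  -- leaves two base cases.
  suc-mod-2 : ∀ m → suc m mod 2 ≡ opposite (m mod 2)
  suc-mod-2 0             = refl
  suc-mod-2 1             = refl
  suc-mod-2 (suc (suc m)) = suc-mod-2 m

  -- The path starts among the nodes that know `t` and ends outside; its first step that leaves them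
  -- is the edge.
  frontier : ∀ {n N} (G : Graph n) (T : Knowledge n N) {t u v} → Star (λ x y → adj G x y ≡ true) u v →
             t ∈ T u → t ∉ T v → ∃[ x ] ∃[ y ] adj G x y ≡ true × t ∈ T x × t ∉ T y
  frontier G T stop t∈ t∉ = contradiction t∈ t∉
  frontier G T {t} {u} (_◅_ {j = w} uw path) t∈ t∉ with t ∈? T w
  ... | yes t∈w = frontier G T path t∈w t∉
  ... | no  t∉w = u , w , uw , t∈ , t∉w

  -- One round of SharedBit with its shared bits fixed.

  module SharedBitRound {n N k q : ℕ} {ε : ℚ} (I : GossipInstance n N k) (𝒯 : Transfer q N ε) where
    open GossipInstance I
    open Potential I
    open Transfer 𝒯

    -- `holder-knows` provides the starting point of a path to a node that misses a token.
    -- `labelled` guarantees that a transferred token is one that `Φ` counts.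
    record Consistent (T : Knowledge n N) : Set where
      field
        holder-knows : ∀ i → label i ∈ T (holder i)
        labelled     : ∀ u {t} → t ∈ T u → ∃[ i ] label i ≡ t

    open Consistent

    initial-consistent : Consistent initial
    initial-consistent = record
      { holder-knows = λ i → Vecₚ.lookup⇒[]= (label i) (initial (holder i))
          (trans (Vecₚ.lookup∘tabulate _ (label i)) (dec-true (holds? (holder i) (label i)) (i , refl , refl)))
      ; labelled     = λ u {t} t∈ → held u t (trans (sym (Vecₚ.lookup∘tabulate _ t)) (Vecₚ.[]=⇒lookup t∈))
      }
      where
      holds? : ∀ u t → Dec (∃[ i ] holder i ≡ u × label i ≡ t)
      holds? u t = any? λ i → (holder i ≟ u) ×-dec (label i ≟ t)
      held : ∀ u t → does (holds? u t) ≡ true → ∃[ i ] label i ≡ t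
      held u t d with holds? u t
      ... | yes (i , _ , eq) = i , eq

    evolves-consistent : ∀ {T T′} → Evolves T T′ → Consistent T → Consistent T′
    evolves-consistent e con = record
      { holder-knows = λ i → keeps e (holder i) (holder-knows con i)
      ; labelled     = λ u t∈ → labelled con (proj₁ (gains e u t∈)) (proj₂ (gains e u t∈))
      }

    Bundles : Set
    Bundles = Fin N → Fin (suc ⌈log₂ N ⌉) → Bit

    -- By definition the law of a single group of `randomString`, which is what allows one group to
    -- be redrawn.
    randomBundles : Rand Bundles
    randomBundles = independently λ _ → independently λ _ → uniform 2 return

    bitOf : Bundles → Subset N → Fin N → ℕ
    bitOf bundle S t = if does (t ∈? S) then toℕ (bundle t zero) else 0

    bitOf-cong : ∀ {bundle bundle′} S t → bundle t ≡ bundle′ t → bitOf bundle S t ≡ bitOf bundle′ S t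
    bitOf-cong S t eq = cong (λ b → if does (t ∈? S) then toℕ (b zero) else 0) eq

    tag : Bundles → Subset N → Bit
    tag = tagBit I 𝒯

    tag-cong : ∀ bundle bundle′ S → (∀ t → t ∈ S → bundle t zero ≡ bundle′ t zero) → tag bundle S ≡ tag bundle′ S
    tag-cong bundle bundle′ S eq = cong (_mod 2) (∑ℕ-cong bits)
      where
      bits : ∀ t → bitOf bundle S t ≡ bitOf bundle′ S t
      bits t with t ∈? S
      ... | yes t∈ = cong toℕ (eq t t∈)
      ... | no  _  = refl

    -- As `t` lies in `S` and no other bundle changes, the sum of the bits grows by exactly one.
    tag-flip : ∀ bundle bundle′ S t → t ∈ S → bundle t zero ≡ zero → bundle′ t zero ≡ suc zero →
               (∀ s → s ≢ t → bundle′ s ≡ bundle s) → tag bundle′ S ≡ opposite (tag bundle S)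
    tag-flip bundle bundle′ S t t∈ b≡0 b′≡1 eq =
      trans (cong (_mod 2) (∑ℕ-suc (bitOf bundle S) (bitOf bundle′ S) t bits λ s s≢t → bitOf-cong {bundle′} {bundle} S s (eq s s≢t)))
            (suc-mod-2 (∑ℕ (bitOf bundle S)))
      where
      bits : bitOf bundle′ S t ≡ suc (bitOf bundle S t)
      bits rewrite dec-true (t ∈? S) t∈ | b≡0 | b′≡1 = refl

    module _ (bundle : Bundles) (G : Graph n) (T : Knowledge n N) where

      private
        rule = sharedBitRule I 𝒯 bundle
        β : Fin n → Bit
        β u = tag bundle (T u)

      -- `only-1-to-0` makes nodes of tag 0 silent and forces connected nodes to have different
      -- tags; `proposes` excludes a wasted round at an edge with tags 1 and 0.
      record Proposal (u : Fin n) (p : Maybe (Fin n)) : Set where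
        field
          only-1-to-0 : ∀ {v} → p ≡ just v → β u ≡ suc zero × β v ≡ zero
          proposes    : ∀ {v} → adj G u v ≡ true → β u ≡ suc zero → β v ≡ zero → ∃[ w ] p ≡ just w

      open Proposal

      proposal-spec : ∀ u → Always (Proposal u) (proposeFor (β u) (viewOf G rule T u))
      proposal-spec u with β u in βu
      ... | zero     = record { only-1-to-0 = λ () ; proposes = λ _ βu≡1 _ → contradiction (trans (sym βu) βu≡1) λ () }
      ... | suc zero = Always-map spec (uniformFrom targets) (uniformFrom-spec targets)
        where
        view = viewOf G rule T u
        zero? = λ v → ≡-dec _≟ᵗ_ (view v) (just (zero ∷ []))
        targets = zeroNeighbors view
        view-zero⁻ : ∀ v → view v ≡ just (zero ∷ []) → β v ≡ zero
        view-zero⁻ v eq with adj G u v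
        ... | true = Vecₚ.∷-injectiveˡ (just-injective eq)
        view-zero⁺ : ∀ v → adj G u v ≡ true → β v ≡ zero → view v ≡ just (zero ∷ [])
        view-zero⁺ v uv βv rewrite uv | βv = refl
        spec : ∀ {p} → (∃[ x ] p ≡ just x × x ∈ˡ targets) ⊎ (p ≡ nothing × targets ≡ []) → Proposal u p
        spec (inj₁ (x , refl , x∈)) = record
          { only-1-to-0 = λ { refl → βu , view-zero⁻ x (proj₂ (∈-filter⁻ zero? {xs = allFin n} x∈)) }
          ; proposes    = λ _ _ _ → x , refl
          }
        spec (inj₂ (refl , none)) = record
          { only-1-to-0 = λ ()
          ; proposes    = λ {v} uv _ βv → contradiction
              (subst (v ∈ˡ_) none (∈-filter⁺ zero? (∈-allFin v) (view-zero⁺ v uv βv))) λ ()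
          }

      both? : (t : Fin N) → Decidable (λ (out : Subset N × Subset N) → (t ∈ proj₁ out) × (t ∈ proj₂ out))
      both? t out = (t ∈? proj₁ out) ×-dec (t ∈? proj₂ out)

      -- Only the connection at `z` is examined, since the others cannot raise `W`. The bound then
      -- depends on one coordinate of the outcomes, and the expectation reduces to a single run of
      -- Transfer.
      connected-progress : Consistent T → ε ≤ ½ → ∀ proposal accepted {w z} →
        proposal z ≡ nothing → proposal w ≡ just z → accepted z ≡ just w → T w ≢ T z →
        E (outcomes G rule T accepted) (λ outcome → W (update G rule T proposal accepted outcome)) ≤ ¾ * W T
      connected-progress con ε≤½ proposal accepted {w} {z} pz pw az Tw≢Tz = begin
        E (outcomes G rule T accepted) (λ outcome → W (update G rule T proposal accepted outcome))
          ≤⟨ E-mono-≤ (outcomes G rule T accepted)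
               (Always-map (λ {outcome} → W-update outcome) (outcomes G rule T accepted)
                 (Always-independently _ (connection-outcome G rule T accepted))) ⟩
        E (outcomes G rule T accepted) (λ outcome → bound (outcome z))
          ≡⟨ E-marginal (connection G rule T accepted) z bound ⟩
        E (connection G rule T accepted z) bound
          ≡⟨ E-connection G rule T accepted az bound ⟩
        E transferRun (λ out → W T + (- ½ * W T) * 𝟙 (both? t) out)
          ≡⟨ E-+ transferRun (λ _ → W T) (λ out → (- ½ * W T) * 𝟙 (both? t) out) ⟩
        E transferRun (λ _ → W T) + E transferRun (λ out → (- ½ * W T) * 𝟙 (both? t) out)
          ≡⟨ cong₂ _+_ (E-const transferRun (W T)) (E-* transferRun (- ½ * W T) (𝟙 (both? t))) ⟩
        W T + (- ½ * W T) * E transferRun (𝟙 (both? t))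
          -- The coefficient is nonpositive, so a lower bound on the probability of success becomes
          -- an upper bound here.
          ≤⟨ +-monoʳ-≤ (W T) (*-monoˡ-≤-nonPos (- ½ * W T)
               {{ loss-nonPos}} half≤success) ⟩
        W T + (- ½ * W T) * ½
          ≡⟨ solve 1 (λ x → x :+ (con′ (- ½) :* x) :* con′ ½ := con′ ¾ :* x) refl (W T) ⟩
        ¾ * W T ∎
        where
        open ≤-Reasoning
        open Data.Rational.Solver.+-*-Solver renaming (con to con′)
        transferRun = run (id w) (id z) (T w) (T z)
        difference = smallestDifference (T w) (T z) Tw≢Tz
        t = proj₁ difference
        t∈D = proj₁ (proj₂ difference)
        t∉∩ : t ∉ T w ∩ T z
        t∉∩ = x∈p─q⇒x∉q t∈D
        t∈∪ : t ∈ T w ⊎ t ∈ T z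
        t∈∪ = x∈p∪q⁻ (T w) (T z) (p─q⊆p (T w ∪ T z) (T w ∩ T z) t∈D)

        bound : Maybe (Subset N × Subset N) → ℚ
        -- A default without weight: since `z` accepts `w`, the connection at `z` always yields
        -- `just`.
        bound nothing    = W T
        bound (just out) = W T + (- ½ * W T) * 𝟙 (both? t) out

        loss-nonPos : NonPositive (- ½ * W T)
        loss-nonPos = nonPos*nonNeg⇒nonPos (- ½) (W T) {{nonNegative (0≤W T)}}

        half≤success : ½ ≤ E transferRun (𝟙 (both? t))
        half≤success = begin
          1ℚ - ½                                ≤⟨ +-monoʳ-≤ 1ℚ (neg-antimono-≤ ε≤½) ⟩
          1ℚ - ε                                ≤⟨ transfer (id w) (id z) (T w) (T z) t (proj₂ difference) ⟩
          Pr transferRun (both? t)              ≡⟨ Pr≡E𝟙 transferRun (both? t) ⟩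
          E transferRun (𝟙 (both? t))           ∎

        W-update : ∀ outcome → (∀ v → Outcome G rule T (accepted v) v (outcome v)) →
                   W (update G rule T proposal accepted outcome) ≤ bound (outcome z)
        W-update outcome ok with outcome z in oz
        ... | nothing = W-mono (keeps (update-evolves G rule T proposal accepted outcome ok))
        ... | just out with both? t out
        ...   | no ¬t∈ = begin
          W T′                       ≤⟨ W-mono (keeps (update-evolves G rule T proposal accepted outcome ok)) ⟩
          W T                        ≡⟨ solve 1 (λ x → x := x :+ (con′ (- ½) :* x) :* con′ 0ℚ) refl (W T) ⟩
          W T + (- ½ * W T) * 0ℚ     ≡⟨ cong (λ x → W T + (- ½ * W T) * x) (𝟙-false (both? t) ¬t∈) ⟨
          bound (just out)           ∎
          where T′ = update G rule T proposal accepted outcome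
        ...   | yes (t∈₁ , t∈₂) = begin
          W T′                       ≤⟨ halved ⟩
          ½ * W T                    ≡⟨ solve 1 (λ x → con′ ½ :* x := x :+ (con′ (- ½) :* x) :* con′ 1ℚ) refl (W T) ⟩
          W T + (- ½ * W T) * 1ℚ     ≡⟨ cong (λ x → W T + (- ½ * W T) * x) (𝟙-true (both? t) (t∈₁ , t∈₂)) ⟨
          bound (just out)           ∎
          where
          T′ = update G rule T proposal accepted outcome
          T⊆T′ = keeps (update-evolves G rule T proposal accepted outcome ok)
          t∈w : t ∈ T′ w
          t∈w = subst (t ∈_) (sym (trans (update-proposer G rule T proposal accepted outcome pw az) (cong (maybe′ proj₁ (T w)) oz))) t∈₁
          t∈z : t ∈ T′ z
          t∈z = subst (t ∈_) (sym (trans (update-acceptor G rule T proposal accepted outcome pz) (cong (maybe′ proj₂ (T z)) oz))) t∈₂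
          gained : ∀ {x} → t ∉ T x → t ∈ T′ x → ∃[ i ] label i ≡ t → W T′ ≤ ½ * W T
          gained {x} t∉ t∈ (i , eq) = W-halves {i = i} T⊆T′ (subst (_∉ T x) (sym eq) t∉) (subst (_∈ T′ x) (sym eq) t∈)
          halved : W T′ ≤ ½ * W T
          -- `t` lies in exactly one of the two sets, and the other end of the connection is the
          -- node that gains it.
          halved with t∈∪
          ... | inj₁ t∈Tw = gained (λ t∈Tz → t∉∩ (x∈p∩q⁺ (t∈Tw , t∈Tz))) t∈z (labelled con w t∈Tw)
          ... | inj₂ t∈Tz = gained (λ t∈Tw → t∉∩ (x∈p∩q⁺ (t∈Tw , t∈Tz))) t∈w (labelled con z t∈Tz)

      -- `x` surely proposes, though to some `z` of tag 0 that need not be `y`. This `z` is silent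
      -- and so accepts some `w`, which need not be `x`. As `w` proposed to `z`, their tags differ,
      -- hence so do their token sets.
      edge-progress : Consistent T → ε ≤ ½ → ∀ {x y} → adj G x y ≡ true → β x ≡ suc zero → β y ≡ zero →
                      E (runRound G rule T) W ≤ ¾ * W T
      edge-progress con ε≤½ {x} {y} xy βx βy = begin
        E (runRound G rule T) W
          ≡⟨ E-runRound G rule T W ⟩
        E (proposals G rule T) (λ proposal → E (acceptances G rule proposal) (λ accepted →
          E (outcomes G rule T accepted) (λ outcome → W (update G rule T proposal accepted outcome))))
          ≤⟨ E-mono-≤ (proposals G rule T)
               (Always-map (λ {proposal} → given-proposal proposal) (proposals G rule T)
                 (Always-independently _ proposal-spec)) ⟩
        E (proposals G rule T) (λ _ → ¾ * W T)
          ≡⟨ E-const (proposals G rule T) (¾ * W T) ⟩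
        ¾ * W T ∎
        where
        open ≤-Reasoning
        given-proposal : ∀ proposal → (∀ u → Proposal u (proposal u)) →
          E (acceptances G rule proposal) (λ accepted →
            E (outcomes G rule T accepted) (λ outcome → W (update G rule T proposal accepted outcome))) ≤ ¾ * W T
        given-proposal proposal ok with proposes (ok x) xy βx βy
        ... | z , px = begin
          E (acceptances G rule proposal) (λ accepted →
            E (outcomes G rule T accepted) (λ outcome → W (update G rule T proposal accepted outcome)))
            ≤⟨ E-mono-≤ (acceptances G rule proposal)
                 (Always-map (λ {accepted} ok′ → given-accepted accepted (ok′ z)) (acceptances G rule proposal)
                   (Always-independently _ accepts)) ⟩
          E (acceptances G rule proposal) (λ _ → ¾ * W T)
            ≡⟨ E-const (acceptances G rule proposal) (¾ * W T) ⟩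
          ¾ * W T ∎
          where
          0≢1 : ∀ {b : Bit} → b ≡ zero → b ≡ suc zero → ⊥
          0≢1 refl ()
          silent : ∀ {v} → β v ≡ zero → proposal v ≡ nothing
          silent {v} βv with proposal v in pv
          ... | nothing = refl
          ... | just _  = contradiction (proj₁ (only-1-to-0 (ok v) pv)) (0≢1 βv)
          pz : proposal z ≡ nothing
          pz = silent (proj₂ (only-1-to-0 (ok x) px))
          Accepted : Fin n → Maybe (Fin n) → Set
          -- Vacuous away from `z`, so that it can be imposed on every coordinate of an independent
          -- draw.
          Accepted v a = v ≡ z → ∃[ w ] a ≡ just w × proposal w ≡ just z
          accepts : ∀ v → Always (Accepted v) (accept G rule proposal v)
          accepts v with v ≟ z
          ... | yes refl = Always-map (λ a _ → a) (accept G rule proposal z) (acceptor-accepts G rule proposal pz px)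
          ... | no  v≢z  = always (λ _ v≡z → contradiction v≡z v≢z) (accept G rule proposal v)
          given-accepted : ∀ accepted → Accepted z (accepted z) →
            E (outcomes G rule T accepted) (λ outcome → W (update G rule T proposal accepted outcome)) ≤ ¾ * W T
          given-accepted accepted acc with acc refl
          ... | w , az , pw = connected-progress con ε≤½ proposal accepted pz pw az λ Tw≡Tz →
            0≢1 (proj₂ (only-1-to-0 (ok w) pw)) (trans (cong (tag bundle) (sym Tw≡Tz)) (proj₁ (only-1-to-0 (ok w) pw)))

      tags-differ-progress : Consistent T → ε ≤ ½ → ∀ {x y} → adj G x y ≡ true → β x ≢ β y →
                             E (runRound G rule T) W ≤ ¾ * W T
      tags-differ-progress con ε≤½ {x} {y} xy βx≢βy with β x in βx | β y in βy
      ... | zero     | zero     = contradiction refl βx≢βy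
      ... | suc zero | suc zero = contradiction refl βx≢βy
      ... | suc zero | zero     = edge-progress con ε≤½ xy βx βy
      ... | zero     | suc zero = edge-progress con ε≤½ (trans (symmetric G y x) xy) βy βx

      -- The fallback for rounds in which gossip is already solved or the two tags agree.
      E-runRound-≤ : E (runRound G rule T) W ≤ W T
      E-runRound-≤ = ≤-trans
        (E-mono-≤ (runRound G rule T) (Always-map (λ e → W-mono (keeps e)) (runRound G rule T) (runRound-evolves G rule T)))
        (≤-reflexive (E-const (runRound G rule T) (W T)))

  -- Averaging over the shared bits of one round.

  -- The bound on the expected potential after a round that starts at potential `x`, given the tags
  -- of the two ends of an edge.
  differ : Bit → Bit → ℚ → ℚ
  differ b b′ x = if does (b ≟ b′) then x else ¾ * x

  -- Exactly one of `b` and its complement agrees with `b′`, and ½(1 + ¾) = ⅞. The summand `0ℚ` is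
  -- the empty tail of a sum over `Fin 2`.
  differ-average : ∀ b b′ x → (1ℤ / 2) * (differ b b′ x + (differ (opposite b) b′ x + 0ℚ)) ≡ ⅞ * x
  differ-average b b′ x = average b b′
    where
    open Data.Rational.Solver.+-*-Solver renaming (con to con′)
    same-first : (1ℤ / 2) * (x + (¾ * x + 0ℚ)) ≡ ⅞ * x
    same-first = solve 1 (λ x → con′ ½ :* (x :+ (con′ ¾ :* x :+ con′ 0ℚ)) := con′ ⅞ :* x) refl x
    same-second : (1ℤ / 2) * (¾ * x + (x + 0ℚ)) ≡ ⅞ * x
    same-second = solve 1 (λ x → con′ ½ :* (con′ ¾ :* x :+ (x :+ con′ 0ℚ)) := con′ ⅞ :* x) refl x
    average : ∀ b b′ → (1ℤ / 2) * (differ b b′ x + (differ (opposite b) b′ x + 0ℚ)) ≡ ⅞ * x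
    average zero       zero       = same-first
    average zero       (suc zero) = same-second
    average (suc zero) zero       = same-second
    average (suc zero) (suc zero) = same-first

  module SharedBitExecution {n N k q : ℕ} {ε : ℚ} (I : GossipInstance n N k) (𝒯 : Transfer q N ε) (ε≤½ : ε ≤ ½) where
    open GossipInstance I
    open Potential I
    open SharedBitRound I 𝒯
    open Consistent

    -- With all other bits fixed, the first bit of bundle `t` is redrawn: changing it complements
    -- the tag of `S` and leaves the tag of `S′` alone.
    tags-average : ∀ S S′ {t} → t ∈ S → t ∉ S′ → ∀ x →
      E randomBundles (λ bundle → differ (tag bundle S) (tag bundle S′) x) ≡ ⅞ * x
    tags-average S S′ {t} t∈ t∉ x = begin
      E randomBundles value
        -- Overwriting bundle `t` by itself changes nothing, but puts the integrand in a form that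
        -- sees this bundle only through its second argument.
        ≡⟨ E-cong randomBundles (λ bundle → value-cong bundle (VF.updateAt bundle t (const (bundle t))) λ s → sym (same bundle s)) ⟩
      E randomBundles (λ bundle → redrawn bundle (bundle t))
        ≡⟨ E-redraw (λ _ → randomBundle) t redrawn (λ g g′ b g≗g′ → value-cong (VF.updateAt g t (const b)) (VF.updateAt g′ t (const b)) λ s → elsewhere g g′ b g≗g′ s (s ≟ t)) ⟩
      E randomBundles (λ bundle → E randomBundle (redrawn bundle))
        ≡⟨ E-cong randomBundles average ⟩
      E randomBundles (λ _ → ⅞ * x)
        ≡⟨ E-const randomBundles (⅞ * x) ⟩
      ⅞ * x ∎
      where
      open ≡-Reasoning
      Bundle = Fin (suc ⌈log₂ N ⌉) → Bit
      randomBundle : Rand Bundle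
      randomBundle = independently λ _ → uniform 2 return

      value : Bundles → ℚ
      value bundle = differ (tag bundle S) (tag bundle S′) x

      value-cong : ∀ g g′ → (∀ s → g s zero ≡ g′ s zero) → value g ≡ value g′
      value-cong g g′ eq = cong₂ (λ b b′ → differ b b′ x) (tag-cong g g′ S λ s _ → eq s) (tag-cong g g′ S′ λ s _ → eq s)

      redrawn : Bundles → Bundle → ℚ
      redrawn g b = value (VF.updateAt g t (const b))

      updated : ∀ g b → VF.updateAt g t (const b) t ≡ b
      updated g b = VFₚ.updateAt-updates t g

      other : ∀ g b {s} → s ≢ t → VF.updateAt g t (const b) s ≡ g s
      other g b {s} s≢t = VFₚ.updateAt-minimal s t g s≢t

      same : ∀ g s → VF.updateAt g t (const (g t)) s zero ≡ g s zero
      same g s with s ≟ t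
      ... | yes refl = cong (_$ zero) (updated g (g t))
      ... | no  s≢t  = cong (_$ zero) (other g (g t) s≢t)

      elsewhere : ∀ g g′ b → (∀ s → s ≢ t → g s ≡ g′ s) → ∀ s → Dec (s ≡ t) →
                  VF.updateAt g t (const b) s zero ≡ VF.updateAt g′ t (const b) s zero
      elsewhere g g′ b g≗g′ s (yes refl) = cong (_$ zero) (trans (updated g b) (sym (updated g′ b)))
      elsewhere g g′ b g≗g′ s (no s≢t) =
        cong (_$ zero) (trans (other g b s≢t) (trans (g≗g′ s s≢t) (sym (other g′ b s≢t))))

      average : ∀ g → E randomBundle (redrawn g) ≡ ⅞ * x
      average g = begin
        E randomBundle (redrawn g)
          -- Only the first bit of the bundle enters a tag, so a constant bundle may replace it,
          -- which leaves an average over one fair bit.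
          ≡⟨ E-cong randomBundle (λ b → value-cong (VF.updateAt g t (const b)) (VF.updateAt g t (const (const (b zero)))) λ s → only-first b s (s ≟ t)) ⟩
        E randomBundle (λ b → redrawn g (const (b zero)))
          ≡⟨ E-marginal {n = suc ⌈log₂ N ⌉} (λ _ → uniform 2 return) zero (λ c → redrawn g (const c)) ⟩
        (1ℤ / 2) * (redrawn g (const zero) + (redrawn g (const (suc zero)) + 0ℚ))
          ≡⟨ cong₂ (λ b b′ → (1ℤ / 2) * (redrawn g (const zero) + (differ b b′ x + 0ℚ))) flips stays ⟩
        (1ℤ / 2) * (redrawn g (const zero) + (differ (opposite (tag g₀ S)) (tag g₀ S′) x + 0ℚ))
          ≡⟨ differ-average (tag g₀ S) (tag g₀ S′) x ⟩
        ⅞ * x ∎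
        where
        g₀ g₁ : Bundles
        g₀ = VF.updateAt g t (const (const zero))
        g₁ = VF.updateAt g t (const (const (suc zero)))
        only-first : ∀ b s → Dec (s ≡ t) →
          VF.updateAt g t (const b) s zero ≡ VF.updateAt g t (const (const (b zero))) s zero
        only-first b s (yes refl) = trans (cong (_$ zero) (updated g b)) (sym (cong (_$ zero) (updated g (const (b zero)))))
        only-first b s (no s≢t)   = cong (_$ zero) (trans (other g b s≢t) (sym (other g (const (b zero)) s≢t)))
        g₁≡g₀ : ∀ s → s ≢ t → g₁ s ≡ g₀ s
        g₁≡g₀ s s≢t = trans (other g _ s≢t) (sym (other g _ s≢t))
        flips : tag g₁ S ≡ opposite (tag g₀ S)
        flips = tag-flip g₀ g₁ S t t∈ (cong (_$ zero) (updated g _)) (cong (_$ zero) (updated g _)) g₁≡g₀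
        stays : tag g₁ S′ ≡ tag g₀ S′
        stays = tag-cong g₁ g₀ S′ λ s s∈ → cong (_$ zero) (g₁≡g₀ s λ { refl → t∉ s∈ })

    -- In a solved state both sides vanish. Otherwise a missing token and a path from its holder
    -- yield an edge whose ends differ on it, chosen before the bits are averaged.
    bundles-progress : ∀ (G : Graph n) T → Consistent T →
      E randomBundles (λ bundle → E (runRound G (sharedBitRule I 𝒯 bundle) T) W) ≤ ⅞ * W T
    bundles-progress G T con with all? (λ u → all? λ i → label i ∈? T u)
    ... | yes solved = begin
      E randomBundles (λ bundle → E (runRound G (sharedBitRule I 𝒯 bundle) T) W)
        ≤⟨ E-mono-≤ randomBundles (always (λ bundle → E-runRound-≤ bundle G T) randomBundles) ⟩
      E randomBundles (λ _ → W T)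
        ≡⟨ E-const randomBundles (W T) ⟩
      W T
        ≡⟨ trans (W-solved {T} solved) (trans (sym (*-zeroʳ ⅞)) (cong (⅞ *_) (sym (W-solved {T} solved)))) ⟩
      ⅞ * W T ∎
      where open ≤-Reasoning
    ... | no ¬solved with ¬∀⟶∃¬ n (λ u → ∀ i → label i ∈ T u) (λ u → all? λ i → label i ∈? T u) ¬solved
    ... | v , ¬v with ¬∀⟶∃¬ k (λ i → label i ∈ T v) (λ i → label i ∈? T v) ¬v
    ... | i , i∉v with frontier G T (connected G (holder i) v) (holder-knows con i) i∉v
    ... | x , y , xy , i∈x , i∉y = begin
      E randomBundles (λ bundle → E (runRound G (sharedBitRule I 𝒯 bundle) T) W)
        ≤⟨ E-mono-≤ randomBundles (always given randomBundles) ⟩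
      E randomBundles (λ bundle → differ (tag bundle (T x)) (tag bundle (T y)) (W T))
        ≡⟨ tags-average (T x) (T y) i∈x i∉y (W T) ⟩
      ⅞ * W T ∎
      where
      open ≤-Reasoning
      given : ∀ bundle → E (runRound G (sharedBitRule I 𝒯 bundle) T) W ≤
                         differ (tag bundle (T x)) (tag bundle (T y)) (W T)
      given bundle with tag bundle (T x) ≟ tag bundle (T y)
      ... | yes _  = E-runRound-≤ bundle G T
      ... | no  x≢y = tags-differ-progress bundle G T con ε≤½ xy x≢y

    -- The expected potential along an execution.

    module _ (c : ℕ) (G : Topology n) (later : Continuation c n N) where

      step : SharedString c N → ∀ {r} → History n N r → Rand (Knowledge n N)
      step = sharedBitStep c I G 𝒯 later

      run-to : SharedString c N → ∀ r → Rand (History n N r)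
      run-to r̂ = execute initial (step r̂)

      step≡ : ∀ r̂ {r} (r< : r ℕ.< c ℕ.* N ℕ.^ 2) (h : History n N r) →
              step r̂ h ≡ runRound (G r) (sharedBitRule I 𝒯 (r̂ (fromℕ< r<))) (head h)
      step≡ r̂ {r} r< h with r ℕₚ.<? c ℕ.* N ℕ.^ 2
      ... | yes _  = refl
      ... | no  r≮ = contradiction r< r≮

      E-run-suc : ∀ r̂ r (f : Knowledge n N → ℚ) →
        E (run-to r̂ (suc r)) (f ∘ head) ≡ E (run-to r̂ r) (λ h → E (step r̂ h) f)
      E-run-suc r̂ r f = trans
        (E->>= (run-to r̂ r) (λ h → step r̂ h >>= λ T → return (T ∷ h)) (f ∘ head))
        (E-cong (run-to r̂ r) λ h → E->>= (step r̂ h) (λ T → return (T ∷ h)) (f ∘ head))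

      -- The bound on `r` keeps the run within the shared string: afterwards `later` is arbitrary
      -- and may even erase knowledge.
      run-consistent : ∀ r̂ {r} → r ℕ.≤ c ℕ.* N ℕ.^ 2 → Always (Consistent ∘ head) (run-to r̂ r)
      run-consistent r̂ {zero}  r≤ = initial-consistent
      run-consistent r̂ {suc r} r< = Always->>= (run-to r̂ r) _ (run-consistent r̂ (ℕₚ.<⇒≤ r<)) λ h con →
        Always->>= (step r̂ h) _
          (subst (Always (Evolves (head h))) (sym (step≡ r̂ r< h))
            (runRound-evolves (G r) (sharedBitRule I 𝒯 (r̂ (fromℕ< r<))) (head h)))
          λ T e → evolves-consistent e con

      -- Each round reads only its own group, so strings that agree on the first `r` groups induce
      -- the same law of the first `r` rounds. This makes group `r`, counted from 0, fresh for the
      -- next round.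
      run-cong : ∀ r̂ r̂′ r → r ℕ.≤ c ℕ.* N ℕ.^ 2 → (∀ j → toℕ j ℕ.< r → r̂ j ≡ r̂′ j) →
        ∀ f → E (run-to r̂ r) f ≡ E (run-to r̂′ r) f
      run-cong r̂ r̂′ zero    r≤ eq f = refl
      run-cong r̂ r̂′ (suc r) r< eq f = begin
        E (run-to r̂ (suc r)) f
          ≡⟨ E->>= (run-to r̂ r) _ f ⟩
        E (run-to r̂ r) (λ h → E (step r̂ h >>= λ T → return (T ∷ h)) f)
          ≡⟨ E-cong (run-to r̂ r) (λ h → cong (λ M → E (M >>= λ T → return (T ∷ h)) f) (step-cong h)) ⟩
        E (run-to r̂ r) (λ h → E (step r̂′ h >>= λ T → return (T ∷ h)) f)
          ≡⟨ run-cong r̂ r̂′ r (ℕₚ.<⇒≤ r<) (λ j j<r → eq j (ℕₚ.m<n⇒m<1+n j<r)) _ ⟩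
        E (run-to r̂′ r) (λ h → E (step r̂′ h >>= λ T → return (T ∷ h)) f)
          ≡⟨ E->>= (run-to r̂′ r) _ f ⟨
        E (run-to r̂′ (suc r)) f ∎
        where
        open ≡-Reasoning
        step-cong : ∀ h → step r̂ h ≡ step r̂′ h
        step-cong h = trans (step≡ r̂ r< h) (trans
          (cong (λ bundle → runRound (G r) (sharedBitRule I 𝒯 bundle) (head h))
            (eq (fromℕ< r<) (ℕₚ.≤-reflexive (cong suc (toℕ-fromℕ< r<)))))
          (sym (step≡ r̂′ r< h)))

      potential : ℕ → ℚ
      potential r = E (randomString c N) (λ r̂ → E (run-to r̂ r) (W ∘ head))

      -- The history of the first r rounds does not depend on group r of the
      -- shared string, which may therefore be redrawn for round r.
      potential-suc : ∀ {r} → r ℕ.< c ℕ.* N ℕ.^ 2 → potential (suc r) ≤ ⅞ * potential r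
      potential-suc {r} r< = begin
        potential (suc r)
          ≡⟨ E-cong (randomString c N) (λ r̂ → trans (E-run-suc r̂ r W)
               (E-cong (run-to r̂ r) λ h → cong (λ M → E M W) (step≡ r̂ r< h))) ⟩
        E (randomString c N) (λ r̂ → F r̂ (r̂ ρ))
          ≡⟨ E-redraw (λ _ → randomBundles) ρ F (λ r̂ r̂′ b eq →
               run-cong r̂ r̂′ r (ℕₚ.<⇒≤ r<) (λ j j<r → eq j λ { refl → ℕₚ.<-irrefl (toℕ-fromℕ< r<) j<r }) _) ⟩
        E (randomString c N) (λ r̂ → E randomBundles (F r̂))
          ≡⟨ E-cong (randomString c N) (λ r̂ → E-swap randomBundles (run-to r̂ r)
               λ bundle h → E (runRound (G r) (sharedBitRule I 𝒯 bundle) (head h)) W) ⟩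
        E (randomString c N) (λ r̂ → E (run-to r̂ r) (λ h →
          E randomBundles (λ bundle → E (runRound (G r) (sharedBitRule I 𝒯 bundle) (head h)) W)))
          ≤⟨ E-mono-≤ (randomString c N) (always (λ r̂ → E-mono-≤ (run-to r̂ r)
               (Always-map (λ {h} con → bundles-progress (G r) (head h) con) (run-to r̂ r)
                 (run-consistent r̂ (ℕₚ.<⇒≤ r<)))) (randomString c N)) ⟩
        E (randomString c N) (λ r̂ → E (run-to r̂ r) (λ h → ⅞ * W (head h)))
          ≡⟨ E-cong (randomString c N) (λ r̂ → E-* (run-to r̂ r) ⅞ (W ∘ head)) ⟩
        E (randomString c N) (λ r̂ → ⅞ * E (run-to r̂ r) (W ∘ head))
          ≡⟨ E-* (randomString c N) ⅞ (λ r̂ → E (run-to r̂ r) (W ∘ head)) ⟩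
        ⅞ * potential r ∎
        where
        open ≤-Reasoning
        ρ = fromℕ< r<
        F : SharedString c N → Bundles → ℚ
        F r̂ bundle = E (run-to r̂ r) (λ h → E (runRound (G r) (sharedBitRule I 𝒯 bundle) (head h)) W)

      potential-≤ : ∀ r → r ℕ.≤ c ℕ.* N ℕ.^ 2 → potential r ≤ ⅞ ^ r * 2ℚ ^ (k ℕ.* n)
      potential-≤ zero    r≤ = begin
        potential 0                   ≡⟨ E-const (randomString c N) (W initial) ⟩
        W initial                     ≤⟨ W-≤ initial ⟩
        2ℚ ^ Φ initial                ≤⟨ ^-monoʳ-≤ 1≤2ℚ (Φ-≤ initial) ⟩
        2ℚ ^ (k ℕ.* n)                ≡⟨ *-identityˡ (2ℚ ^ (k ℕ.* n)) ⟨
        1ℚ * 2ℚ ^ (k ℕ.* n)           ∎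
        where open ≤-Reasoning
      potential-≤ (suc r) r< = begin
        potential (suc r)                 ≤⟨ potential-suc r< ⟩
        ⅞ * potential r                   ≤⟨ *-monoˡ-≤-nonNeg ⅞ (potential-≤ r (ℕₚ.<⇒≤ r<)) ⟩
        ⅞ * (⅞ ^ r * 2ℚ ^ (k ℕ.* n))      ≡⟨ *-assoc ⅞ (⅞ ^ r) (2ℚ ^ (k ℕ.* n)) ⟨
        ⅞ * ⅞ ^ r * 2ℚ ^ (k ℕ.* n)        ∎
        where open ≤-Reasoning

      -- Markov's inequality without complementary events: an unsolved state has `W` at least 1, so
      -- `𝟙 solved? T + W T` is at least 1 pointwise.
      1≤solved+potential : ∀ r →
        1ℚ ≤ Pr (sharedBit c I G 𝒯 later r) (λ h → solved? (head h)) + potential r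
      1≤solved+potential r = begin
        1ℚ
          ≡⟨ E-const X 1ℚ ⟨
        E X (const 1ℚ)
          ≤⟨ E-mono-≤ X (always (λ h → 1≤solved+W (head h)) X) ⟩
        E X (λ h → 𝟙 solvedHead? h + W (head h))
          ≡⟨ E-+ X (𝟙 solvedHead?) (W ∘ head) ⟩
        E X (𝟙 solvedHead?) + E X (W ∘ head)
          ≡⟨ cong₂ _+_ (sym (Pr≡E𝟙 X solvedHead?)) (E->>= (randomString c N) (λ r̂ → run-to r̂ r) (W ∘ head)) ⟩
        Pr X solvedHead? + potential r ∎
        where
        open ≤-Reasoning
        X = sharedBit c I G 𝒯 later r
        solvedHead? : Decidable (λ (h : History n N r) → Solved (head h))
        solvedHead? h = solved? (head h)
        1≤solved+W : ∀ T → 1ℚ ≤ 𝟙 solved? T + W T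
        1≤solved+W T = by (solved? T)
          where
          by : Dec (Solved T) → 1ℚ ≤ 𝟙 solved? T + W T
          by (yes s) = ≤-reflexive (sym (cong₂ _+_ (𝟙-true solved? {T} s) (W-solved {T} s)))
          by (no ¬s) = ≤-trans (1≤p⇒1≤p^m 1≤2ℚ (Φ T))
            (≤-reflexive (trans (sym (+-identityˡ _)) (sym (cong₂ _+_ (𝟙-false solved? {T} ¬s) (W-unsolved {T} ¬s)))))

  -- Numerical estimates.

  ^-≤1 : ∀ {p} .{{_ : NonNegative p}} → p ≤ 1ℚ → ∀ m → p ^ m ≤ 1ℚ
  ^-≤1     p≤1 zero    = ≤-refl
  ^-≤1 {p} p≤1 (suc m) = begin
    p * p ^ m    ≤⟨ *-monoˡ-≤-nonNeg p (^-≤1 p≤1 m) ⟩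
    p * 1ℚ       ≡⟨ *-identityʳ p ⟩
    p            ≤⟨ p≤1 ⟩
    1ℚ           ∎
    where open ≤-Reasoning

  n≤2^n : ∀ m → m ⨯ 1ℚ ≤ 2ℚ ^ m
  n≤2^n zero    = ≤ᵇ⇒≤ _
  n≤2^n (suc m) = begin
    1ℚ + m ⨯ 1ℚ         ≤⟨ +-mono-≤ (1≤p⇒1≤p^m 1≤2ℚ m) (n≤2^n m) ⟩
    2ℚ ^ m + 2ℚ ^ m     ≡⟨ solve 1 (λ x → x :+ x := con′ 2ℚ :* x) refl (2ℚ ^ m) ⟩
    2ℚ * 2ℚ ^ m         ∎
    where
    open ≤-Reasoning
    open Data.Rational.Solver.+-*-Solver renaming (con to con′)

  -- Multiplied by `n`, which is at most 2^m, the left side is at most (4 · ⅞¹¹)^m.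
  decay-≤-1/ : ∀ n .{{_ : NonTrivial n}} {m} → n ℕ.≤ m → ⅞ ^ (11 ℕ.* m) * 2ℚ ^ m ≤ 1/ n
  decay-≤-1/ n {m} n≤m = begin
    d                              ≡⟨ *-identityˡ d ⟨
    1ℚ * d                         ≡⟨ cong (_* d) (1/m*m⨯1≡1 n) ⟨
    1/ n * (n ⨯ 1ℚ) * d            ≡⟨ *-assoc (1/ n) (n ⨯ 1ℚ) d ⟩
    1/ n * ((n ⨯ 1ℚ) * d)          ≤⟨ *-monoˡ-≤-nonNeg (1/ n) n*d≤1 ⟩
    1/ n * 1ℚ                      ≡⟨ *-identityʳ (1/ n) ⟩
    1/ n                           ∎
    where
    open ≤-Reasoning
    instance
      n≢0 : ℕ.NonZero n
      n≢0 = nonTrivial⇒nonZero n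
      1/n-nonNeg : NonNegative (1/ n)
      1/n-nonNeg = 1/m-nonNegative n
    d = ⅞ ^ (11 ℕ.* m) * 2ℚ ^ m
    d≡ : d ≡ (⅞ ^ 11 * 2ℚ) ^ m
    d≡ = trans (cong (_* 2ℚ ^ m) (sym (^-assocʳ ⅞ 11 m))) (sym (^-distrib-* (⅞ ^ 11) 2ℚ m))
    n*d≤1 : (n ⨯ 1ℚ) * d ≤ 1ℚ
    n*d≤1 = begin
      (n ⨯ 1ℚ) * d                      ≡⟨ cong ((n ⨯ 1ℚ) *_) d≡ ⟩
      (n ⨯ 1ℚ) * (⅞ ^ 11 * 2ℚ) ^ m      ≤⟨ *-monoʳ-≤-nonNeg ((⅞ ^ 11 * 2ℚ) ^ m) {{^-nonNeg (⅞ ^ 11 * 2ℚ) m}}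
                                             (≤-trans (n≤2^n n) (^-monoʳ-≤ 1≤2ℚ n≤m)) ⟩
      2ℚ ^ m * (⅞ ^ 11 * 2ℚ) ^ m        ≡⟨ ^-distrib-* 2ℚ (⅞ ^ 11 * 2ℚ) m ⟨
      -- The base is about 0.92. The exponent 11 is the least that brings it below 1.
      (2ℚ * (⅞ ^ 11 * 2ℚ)) ^ m          ≤⟨ ^-≤1 (≤ᵇ⇒≤ _) m ⟩
      1ℚ                                ∎

  -- Since `n` is at least 2, one factor of it suffices. Transfer then succeeds with probability at
  -- least ½.
  ^-≤½ : ∀ n c .{{_ : NonTrivial n}} → 1 ℕ.≤ c → n ^- c ≤ ½
  ^-≤½ n (suc c) (s≤s _) = 1/m≤½ (n ℕ.^ suc c) {{ℕₚ.m^n≢0 n (suc c) {{nonTrivial⇒nonZero n}}}} 2≤n^c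
    where
    2≤n^c : 2 ℕ.≤ n ℕ.^ suc c
    2≤n^c = ℕₚ.≤-trans (ℕ.nonTrivial⇒n>1 n) (ℕₚ.m≤m*n n (n ℕ.^ c) {{ℕₚ.m^n≢0 n c {{nonTrivial⇒nonZero n}}}})
    1/m≤½ : ∀ m .{{_ : ℕ.NonZero m}} → 2 ℕ.≤ m → 1ℤ / m ≤ ½
    1/m≤½ (suc m) 2≤m = toℚᵘ-cancel-≤ (ℚᵘₚ.≤-trans (ℚᵘₚ.≤-reflexive (toℚᵘ-fromℚᵘ (mkℚᵘ 1ℤ m)))
      (*≤* (ℤ.+≤+ (ℕₚ.≤-trans 2≤m (ℕₚ.≤-reflexive (sym (ℕₚ.*-identityˡ (suc m))))))))

  -- The success probability after 11kn rounds.

  module _ {n N k q : ℕ} {ε : ℚ} .{{_ : NonTrivial n}} (n≤N : n ℕ.≤ N) (1≤k : 1 ℕ.≤ k) (k≤n : k ℕ.≤ n)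
           (I : GossipInstance n N k) (𝒯 : Transfer q N ε) (ε≤½ : ε ≤ ½) where
    open GossipInstance I
    open SharedBitExecution I 𝒯 ε≤½

    sharedBit-solves : ∀ {c} → 11 ℕ.≤ c → ∀ G later → SolvesGossip I (sharedBit c I G 𝒯 later) (11 ℕ.* (k ℕ.* n))
    sharedBit-solves {c} 11≤c G later = begin
      1ℚ - 1/ n
        ≤⟨ +-monoˡ-≤ (- (1/ n)) (1≤solved+potential c G later R) ⟩
      P + potential c G later R - 1/ n
        ≤⟨ +-monoˡ-≤ (- (1/ n)) (+-monoʳ-≤ P (≤-trans
             -- As `kn` is at most `N²` and `c` at least 11, all 11kn rounds lie within the shared
             -- string; `1 ≤ k` turns the decay in `kn` into the bound `1/ n`.
             (potential-≤ c G later R (ℕₚ.*-mono-≤ 11≤c kn≤N²)) (decay-≤-1/ n n≤kn))) ⟩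
      P + 1/ n - 1/ n
        ≡⟨ +-assoc P (1/ n) (- (1/ n)) ⟩
      P + (1/ n - 1/ n)
        ≡⟨ cong (P +_) (+-inverseʳ (1/ n)) ⟩
      P + 0ℚ
        ≡⟨ +-identityʳ P ⟩
      P ∎
      where
      open ≤-Reasoning
      R = 11 ℕ.* (k ℕ.* n)
      P = Pr (sharedBit c I G 𝒯 later R) (λ h → solved? (head h))
      kn≤N² : k ℕ.* n ℕ.≤ N ℕ.^ 2
      kn≤N² = ℕₚ.≤-trans (ℕₚ.*-mono-≤ (ℕₚ.≤-trans k≤n n≤N) n≤N)
        (ℕₚ.≤-reflexive (cong (N ℕ.*_) (sym (ℕₚ.*-identityʳ N))))
      n≤kn : n ℕ.≤ k ℕ.* n
      n≤kn = ℕₚ.≤-trans (ℕₚ.≤-reflexive (sym (ℕₚ.*-identityˡ n))) (ℕₚ.*-monoˡ-≤ n 1≤k)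
open SharedBitAnalysis using (sharedBit-solves; ^-≤½)

open import Data.Nat.Base using (ℕ; _*_; _≤_; NonTrivial)
open import Data.Product.Base using (Σ-syntax; _,_)

theorem5p1 : Σ[ C ∈ ℕ ] Σ[ c₀ ∈ ℕ ] Σ[ cₜ₀ ∈ ℕ ]
    ∀ (c cₜ : ℕ) → c₀ ≤ c → cₜ₀ ≤ cₜ →
    ∀ (n N k q : ℕ) .{{_ : NonTrivial n}} → n ≤ N → 1 ≤ k → k ≤ n →
    ∀ (I : GossipInstance n N k)
    (τ : StabilityFactor) (G : Topology n) → Stable τ G →
    ∀ (𝒯 : Transfer q N (n ^- cₜ)) (later : Continuation c n N) →
    SolvesGossip I (sharedBit c I G 𝒯 later) (C * (k * n))
-- The first 11 is the number of rounds per unit of `kn`, the second makes the shared string last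
-- that long, and `cₜ ≥ 1` gives Transfer an error of at most ½.
theorem5p1 = 11 , 11 , 1 , λ c cₜ 11≤c 1≤cₜ n N k q n≤N 1≤k k≤n I τ G _ 𝒯 later →
  sharedBit-solves n≤N 1≤k k≤n I 𝒯 (^-≤½ n cₜ 1≤cₜ) 11≤c G later
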